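{- Let $\mathcal{G}$ be a simple undirected graph and let $\mathcal{T}$ be any dissecting tree set for $\mathcal{G}$. Regard $\mathcal{G}$ as a bidirected graph (each edge $uv$ replaced by the two directed edges $\overrightarrow{uv}$ and $\overrightarrow{vu}$), and fix any total ordering of these directed edges. Then for every $i$, the coefficient of $x^i$ in the $h^*$-polynomial of the symmetric edge polytope $P_{\mathcal{G}}$ equals $$|\{T\in \mathcal{T}\mid T \text{ has exactly } i \text{ internally semi-passive edges}\}|,$$ where internal semi-passivity is taken with respect to the fixed ordering in the bidirected graph.
   Context: For a vertex $u$, $\mathbf{1}_u$ denotes the standard basis vector of $\mathbb{R}^{V(\mathcal{G})}$. The symmetric edge polytope is $P_{\mathcal{G}}=\mathrm{conv}\{\mathbf{1}_u-\mathbf{1}_w,\ \mathbf{1}_w-\mathbf{1}_u \mid uw\in E(\mathcal{G})\}$. For a directed graph $D$, $\mathcal{Q}_D=\mathrm{conv}\{\mathbf{1}_h-\mathbf{1}_t \mid \overrightarrow{th}\in E(D)\}$. An oriented spanning tree of $\mathcal{G}$ is a spanning tree in which each edge is given one of its two orientations (so it is a spanning tree of the bidirected graph). A dissecting tree set for $\mathcal{G}$ is a set $\mathcal{T}$ of oriented spanning trees of $\mathcal{G}$ such that the simplices $\mathcal{Q}_T$, $T\in\mathcal{T}$, have pairwise disjoint relative interiors and their union is the boundary of $P_{\mathcal{G}}$. For a digraph $G$, a spanning tree $T$ and $e\in T$, the fundamental cut $C^*(T,e)$ is the set of edges of $G$ joining the two components (shores) of $T-e$; an edge $e'\in C^*(T,e)$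 stands parallel to $e$ if the heads of $e$ and $e'$ lie in the same shore, and stands opposite to $e$ otherwise. Given a total order on $E(G)$, an edge $e\in T$ is internally semi-passive for $T$ if the maximal edge of $C^*(T,e)$ stands opposite to $e$ (otherwise it is internally semi-active). For a $d$-dimensional lattice polytope $P\subset\mathbb{R}^n$ with Ehrhart polynomial $\varepsilon_P(t)=|tP\cap\mathbb{Z}^n|$, writing uniquely $\varepsilon_P(t)=\sum_{k=0}^d a_k\binom{t+d-k}{d}$, the $h^*$-polynomial of $P$ is $\sum_{k=0}^d a_k x^k$.
   Formalization: Points, convex combinations, relative interiors, boundary and dimension are taken over the rationals instead of the reals (in Q^V rather than R^V), also in the definition of a dissecting tree set; all polytopes involved have integer vertices. -}

module Defs where

open import Data.Nat as ℕ using (ℕ; zero; suc; _≤_; _<_; _∸_)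
open import Data.Nat.Combinatorics using (_C_)
open import Data.Integer using (ℤ)
open import Data.Rational as Q using (ℚ; 0ℚ; 1ℚ; _/_)
open import Data.Fin using (Fin)
open import Data.Bool using (Bool; true; false)
open import Data.Vec as V using (Vec)
open import Data.List as L using (List; []; _∷_; length; upTo)
open import Data.List.Relation.Unary.Unique.Propositional using (Unique)
open import Data.List.Membership.Propositional using (_∈_)
open import Data.Product using (Σ; ∃; ∃-syntax; _×_; _,_)
open import Data.Empty using (⊥)
open import Data.Sum using (_⊎_)
open import Data.Maybe using (just)
open import Data.Integer using (+_)
import Data.Fin as Fin
open import Data.Nat.ListAction using (sum)
open import Relation.Nullary using (¬_)
open import Relation.Binary.PropositionalEquality using (_≡_; _≢_)
open import Function.Bundles using (_⇔_)

sumQ : ∀ {k} → (Fin k → ℚ) → ℚ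
sumQ {zero}  f = 0ℚ
sumQ {suc k} f = f Fin.zero Q.+ sumQ (λ j → f (Fin.suc j))

sumUpTo : ℕ → (ℕ → ℕ) → ℕ
sumUpTo d f = sum (L.map f (upTo (suc d)))

-- a (directed) graph / arc set on Fin n : arc t → h present iff A t h ≡ true
ArcSet : ℕ → Set
ArcSet n = Fin n → Fin n → Bool

record SimpleGraph (n : ℕ) : Set where
  field
    adj   : ArcSet n
    sym   : ∀ u v → adj u v ≡ true → adj v u ≡ true
    loopless : ∀ u → adj u u ≡ false
open SimpleGraph public

Und : ∀ {n} → ArcSet n → Fin n → Fin n → Set
Und A u v = (A u v ≡ true) ⊎ (A v u ≡ true)

data Walk {n} (R : Fin n → Fin n → Set) : Fin n → List (Fin n) → Fin n → Set where
  stop : ∀ {u} → Walk R u [] u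
  step : ∀ {u w ws v} → R u w → Walk R w ws v → Walk R u (w ∷ ws) v

Connected : ∀ {n} → (Fin n → Fin n → Set) → Set
Connected R = ∀ u v → ∃[ ws ] Walk R u ws v

-- a cycle: k ≥ 3 pairwise distinct vertices v₀ … v_{k-1}, consecutive ones
-- adjacent and v_{k-1} adjacent to v₀
HasCycle : ∀ {n} → (Fin n → Fin n → Set) → Set
HasCycle R = ∃[ v₀ ] ∃[ ws ] ∃[ vₗ ]
  (2 ≤ length ws × Unique (v₀ ∷ ws) × L.last ws ≡ just vₗ
   × Walk R v₀ ws vₗ × R vₗ v₀)

IsSpanningTree : ∀ {n} → (Fin n → Fin n → Set) → Set
IsSpanningTree R = Connected R × ¬ HasCycle R

IsOrientedSpanningTree : ∀ {n} → SimpleGraph n → ArcSet n → Set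
IsOrientedSpanningTree G T =
  (∀ u v → T u v ≡ true → adj G u v ≡ true)
  × (∀ u v → T u v ≡ true → T v u ≡ false)
  × IsSpanningTree (Und T)

UndMinus : ∀ {n} → ArcSet n → Fin n → Fin n → Fin n → Fin n → Set
UndMinus T a b u v = Und T u v × ¬ ((u ≡ a × v ≡ b) ⊎ (u ≡ b × v ≡ a))

InShore : ∀ {n} → ArcSet n → Fin n → Fin n → Fin n → Fin n → Set
InShore T a b x w = ∃[ ws ] Walk (UndMinus T a b) x ws w

InCut : ∀ {n} → SimpleGraph n → ArcSet n → (a b t' h' : Fin n) → Set
InCut G T a b t' h' = adj G t' h' ≡ true ×
  ((InShore T a b a t' × InShore T a b b h') ⊎ (InShore T a b b t' × InShore T a b a h'))

-- t' → h' ∈ C*(T, a → b) stands opposite to a → b: its head lies in the shore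
-- containing the tail a (i.e. not in the shore of the head b)
StandsOpposite : ∀ {n} → ArcSet n → (a b t' h' : Fin n) → Set
StandsOpposite T a b t' h' = InShore T a b a h'

-- total order on the arcs of the bidirected graph of G, given by an injective
-- rank function on those arcs (e ≺ e' iff rank e < rank e')
IsArcOrder : ∀ {n} → SimpleGraph n → (Fin n → Fin n → ℕ) → Set
IsArcOrder G rank = ∀ a b c d → adj G a b ≡ true → adj G c d ≡ true →
  rank a b ≡ rank c d → (a ≡ c × b ≡ d)

InternallySemiPassive : ∀ {n} → SimpleGraph n → (Fin n → Fin n → ℕ) → ArcSet n → Fin n → Fin n → Set
InternallySemiPassive G rank T a b =
  ∃[ t' ] ∃[ h' ] (InCut G T a b t' h'
    × (∀ t'' h'' → InCut G T a b t'' h'' → rank t'' h'' ≤ rank t' h')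
    × StandsOpposite T a b t' h')

NumSemiPassive : ∀ {n} → SimpleGraph n → (Fin n → Fin n → ℕ) → ArcSet n → ℕ → Set
NumSemiPassive G rank T k = ∃[ es ]
  (Unique es × length es ≡ k ×
   (∀ a b → (a , b) ∈ es ⇔ (T a b ≡ true × InternallySemiPassive G rank T a b)))

Point : ℕ → Set
Point n = Fin n → ℚ

arcVec : ∀ {n} → Fin n → Fin n → Point n
arcVec {n} t h c = ind h c Q.- ind t c
  where
  open import Data.Fin using (_≟_)
  open import Relation.Nullary using (yes; no)
  ind : Fin n → Fin n → ℚ
  ind u c with u ≟ c
  ... | yes _ = 1ℚ
  ... | no  _ = 0ℚ

sumArcs : ∀ {n} → (Fin n → Fin n → ℚ) → (Fin n → Fin n → ℚ) → ℚ
sumArcs {n} λ' f = sumQ (λ t → sumQ (λ h → λ' t h Q.* f t h))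

ConvArcs : ∀ {n} → ArcSet n → Point n → Set
ConvArcs {n} A x = ∃[ λ' ]
  ((∀ t h → 0ℚ Q.≤ λ' t h) × (∀ t h → A t h ≡ false → λ' t h ≡ 0ℚ)
   × sumArcs λ' (λ _ _ → 1ℚ) ≡ 1ℚ
   × ∀ c → x c ≡ sumArcs λ' (λ t h → arcVec t h c))

AffArcs : ∀ {n} → ArcSet n → Point n → Set
AffArcs {n} A x = ∃[ μ ]
  ((∀ t h → A t h ≡ false → μ t h ≡ 0ℚ)
   × sumArcs μ (λ _ _ → 1ℚ) ≡ 1ℚ
   × ∀ c → x c ≡ sumArcs μ (λ t h → arcVec t h c))

RelInt : ∀ {n} → ArcSet n → Point n → Set
RelInt A x = ConvArcs A x × ∃[ ε ] (0ℚ Q.< ε ×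
  (∀ z → AffArcs A z → (∀ c → Q.∣ z c Q.- x c ∣ Q.< ε) → ConvArcs A z))

Boundary : ∀ {n} → ArcSet n → Point n → Set
Boundary A x = ConvArcs A x × ¬ RelInt A x

-- symmetric edge polytope P_G (G symmetric, so both orientations occur)
SymEdge : ∀ {n} → SimpleGraph n → Point n → Set
SymEdge G = ConvArcs (adj G)

AffIndep : ∀ {n k} → (Fin k → Point n) → Set
AffIndep q = ∀ (γ : Fin _ → ℚ) → sumQ γ ≡ 0ℚ →
  (∀ c → sumQ (λ j → γ j Q.* q j c) ≡ 0ℚ) → ∀ j → γ j ≡ 0ℚ

IsDim : ∀ {n} → (Point n → Set) → ℕ → Set
IsDim P d =
  (∃[ q ] ((∀ j → P (q j)) × AffIndep {k = suc d} q))
  × (∀ q → (∀ j → P (q j)) → ¬ AffIndep {k = suc (suc d)} q)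

DissectingTreeSet : ∀ {n m} → SimpleGraph n → (Fin m → ArcSet n) → Set
DissectingTreeSet {n} G 𝒯 =
  (∀ j → IsOrientedSpanningTree G (𝒯 j))
  × (∀ j j' → (∀ u v → 𝒯 j u v ≡ 𝒯 j' u v) → j ≡ j')
  × (∀ j j' → j ≢ j' → ∀ x → ¬ (RelInt (𝒯 j) x × RelInt (𝒯 j') x))
  × (∀ x → Boundary (adj G) x ⇔ (∃[ j ] ConvArcs (𝒯 j) x))

NumTreesWith : ∀ {n m} → SimpleGraph n → (Fin n → Fin n → ℕ) → (Fin m → ArcSet n) → ℕ → ℕ → Set
NumTreesWith G rank 𝒯 i N = ∃[ js ]
  (Unique js × length js ≡ N × (∀ j → j ∈ js ⇔ NumSemiPassive G rank (𝒯 j) i))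

toQ : ℤ → ℚ
toQ z = z / 1

Dilate : ∀ {n} → ℕ → (Point n → Set) → Point n → Set
Dilate t P x = ∃[ p ] (P p × ∀ c → x c ≡ (+ t / 1) Q.* p c)

LatticeCount : ∀ {n} → (Point n → Set) → ℕ → ℕ → Set
LatticeCount {n} P t N = ∃[ zs ]
  (Unique zs × length zs ≡ N ×
   (∀ (z : Vec ℤ n) → z ∈ zs ⇔ Dilate t P (λ c → toQ (V.lookup z c))))

-- a is the coefficient sequence of the h*-polynomial of the d-dimensional
-- lattice polytope P: a k = 0 for k > d and
-- ε_P(t) = Σ_{k=0}^{d} a_k binom(t+d-k, d) for all t (this determines a uniquely)
IsHStarCoeffs : ∀ {n} → (Point n → Set) → ℕ → (ℕ → ℕ) → Set
IsHStarCoeffs P d a =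
  (∀ k → d < k → a k ≡ 0)
  × (∀ t → LatticeCount P t (sumUpTo d (λ k → a k ℕ.* ((t ℕ.+ d ∸ k) C d))))

-- The gauge r of P_G is the minimal cost of writing a point as a nonnegative combination of arc
-- vectors; the minimum is attained because finitely generated cones are polyhedral, and the boundary
-- of P_G is the set of points of gauge 1.  Hence every point of gauge r lies in r Q_T for some T of the
-- dissection, and its coordinates with respect to the arcs of T are read off by the fundamental cuts,
-- so lattice points have integer coordinates.
--
-- Let q be the sum of the arc vectors weighted by W ^ rank with W large.  The coordinate of q at an arc
-- e of T has the sign with which the maximal arc of C*(T,e) crosses the cut, so it is negative exactly
-- when e is semi-passive.  For z in the lattice, z + ε q (rescaled to M z + q) lies in the interior of the
-- cone of exactly one T; equivalently, z lies in exactly one half-open cone, where coordinates at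
-- semi-passive arcs are required to be positive.  If T has i such arcs, then t P_G contains
-- binom(t + d - i, d) lattice points of its half-open cone.
module Submission where

open import Defs renaming (sym to adj-sym)
open import Data.Nat as ℕ using (ℕ; zero; suc; s≤s; z≤n)
import Data.Nat.Properties as ℕ
open import Data.Nat.Combinatorics using (_C_; nCk+nC[k+1]≡[n+1]C[k+1]; nCn≡1; k>n⇒nCk≡0)
open import Data.Integer as ℤ using (ℤ; -[1+_])
import Data.Integer.Properties as ℤ
open import Data.Rational using (ℚ; 0ℚ; 1ℚ; ½; _+_; _*_; _-_; -_; _≤_; _<_; 1/_; ∣_∣; positive; nonNegative; nonPositive; ≢-nonZero; toℚᵘ)
open import Data.Rational.Properties as ℚ using (≤-refl; ≤-reflexive; ≤-trans; ≤-antisym; <⇒≤; <-≤-trans; ≤-<-trans; ≰⇒>; ≮⇒≥; _≤?_; _<?_)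
import Data.Rational.Unnormalised as ℚᵘ
import Data.Rational.Unnormalised.Properties as ℚᵘ
open import Data.Fin using (Fin; zero; suc; _≟_)
import Data.Fin as Fin
import Data.Fin.Properties as Fin
open import Data.Bool as Bool using (Bool; true; false; if_then_else_)
import Data.Bool.Properties as Bool
open import Data.Vec as Vec using (Vec; []; _∷_)
import Data.Vec.Properties as Vec
open import Data.List as List using (List; []; _∷_; length; map; _++_; concatMap; cartesianProduct; filter; allFin; upTo)
import Data.List.Properties as List
open import Data.List.Relation.Unary.Any.Properties using (lookup-index)
open import Data.List.Relation.Unary.Unique.Propositional using (Unique)
open import Data.List.Relation.Unary.AllPairs using ([]; _∷_)
import Data.List.Relation.Unary.Unique.Propositional.Properties as Unique
open import Data.List.Membership.Propositional using (_∈_; find; lose)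
open import Data.List.Membership.Propositional.Properties using (∈-map⁺; ∈-map⁻; ∈-++⁺ˡ; ∈-++⁺ʳ; ∈-++⁻; ∈-filter⁺; ∈-filter⁻; ∈-cartesianProduct⁺; ∈-cartesianProduct⁻; ∈-allFin; ∈-concatMap⁺; ∈-concatMap⁻; ∈-upTo⁺; ∈-lookup)
open import Data.List.Relation.Unary.All as All using ([]; _∷_)
open import Data.List.Membership.Propositional.Properties.WithK using (unique∧set⇒bag)
open import Data.List.Relation.Binary.BagAndSetEquality using (∼bag⇒↭)
open import Data.List.Relation.Binary.Permutation.Propositional.Properties using (↭-length)
open import Data.Nat.ListAction using (sum)
open import Data.List.Relation.Unary.All.Properties using (¬Any⇒All¬)
open import Data.List.Relation.Unary.Any as Any using (here; there)
open import Data.Maybe using (Maybe; just; nothing)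
open import Data.Product using (Σ; ∃-syntax; _×_; _,_; proj₁; proj₂)
open import Data.Sum as Sum using (_⊎_; inj₁; inj₂; [_,_]′)
open import Data.Empty using (⊥)
open import Function using (_∘_; case_of_)
open import Function.Bundles using (mk⇔; Equivalence)
open import Level using (0ℓ)
open import Relation.Nullary using (¬_; yes; no; does; contradiction)
open import Relation.Nullary.Decidable using (decidable-stable; dec-true; _×-dec_; ¬?)
open import Relation.Binary.PropositionalEquality using (_≡_; _≢_; refl; sym; trans; cong; cong₂; subst; subst₂; module ≡-Reasoning)
open import Tactic.RingSolver using (solve-∀)
open import Tactic.RingSolver.Core.AlmostCommutativeRing using (AlmostCommutativeRing; fromCommutativeRing)

-- The simplices of a dissection need not meet along common faces, so the lattice points that they
-- share cannot be sorted face by face. The half-open cones assign each of them to one tree, and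
-- consistently so, because `q` depends on the order alone and not on a tree. Integrality enters
-- twice. It makes the lattice points of a cone exactly the natural-number combinations of its arcs,
-- and it leaves a gap of 1 between distinct coordinate values, so that one multiplier `M` can
-- replace "ε small enough" for all lattice points at once. The hypotheses on the dissection speak
-- of boundaries and relative interiors, which are defined by small balls. They turn into statements
-- on weights because an arc and its opposite cancel: the weight of a representation can always be
-- raised, and a point is relatively interior to P_G exactly when it has a representation of weight
-- below 1. Over ℚ no compactness argument yields a representation of least weight, hence the
-- elimination.

ℚ-ring : AlmostCommutativeRing 0ℓ 0ℓ
ℚ-ring = fromCommutativeRing ℚ.+-*-commutativeRing 0≟_
  where
  0≟_ : ∀ x → Maybe (0ℚ ≡ x)
  0≟ x with 0ℚ ℚ.≟ x
  ... | yes p = just p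
  ... | no  _ = nothing

-- Ordered-field arithmetic

0<1 : 0ℚ < 1ℚ
0<1 = ℚ.positive⁻¹ 1ℚ

0≤1 : 0ℚ ≤ 1ℚ
0≤1 = <⇒≤ 0<1

+-nonneg : ∀ {p q} → 0ℚ ≤ p → 0ℚ ≤ q → 0ℚ ≤ p + q
+-nonneg = ℚ.+-mono-≤

*-monoˡ : ∀ {c p q} → 0ℚ ≤ c → p ≤ q → c * p ≤ c * q
*-monoˡ {c} 0≤c = ℚ.*-monoˡ-≤-nonNeg c {{nonNegative 0≤c}}

*-monoʳ : ∀ {c p q} → 0ℚ ≤ c → p ≤ q → p * c ≤ q * c
*-monoʳ {c} 0≤c = ℚ.*-monoʳ-≤-nonNeg c {{nonNegative 0≤c}}

*-monoˡ-< : ∀ {c p q} → 0ℚ < c → p < q → c * p < c * q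
*-monoˡ-< {c} 0<c = ℚ.*-monoʳ-<-pos c {{positive 0<c}}

*-nonneg : ∀ {p q} → 0ℚ ≤ p → 0ℚ ≤ q → 0ℚ ≤ p * q
*-nonneg {p} {q} 0≤p 0≤q = subst (_≤ p * q) (ℚ.*-zeroʳ p) (*-monoˡ 0≤p 0≤q)

*-pos : ∀ {p q} → 0ℚ < p → 0ℚ < q → 0ℚ < p * q
*-pos {p} {q} 0<p 0<q = subst (_< p * q) (ℚ.*-zeroʳ p) (*-monoˡ-< 0<p 0<q)

*-cancel-≤ : ∀ {c p q} → 0ℚ < c → c * p ≤ c * q → p ≤ q
*-cancel-≤ {c} 0<c = ℚ.*-cancelˡ-≤-pos c {{positive 0<c}}

≤⇒0≤- : ∀ {p q} → p ≤ q → 0ℚ ≤ q - p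
≤⇒0≤- {p} {q} p≤q = subst (_≤ q - p) (ℚ.+-inverseʳ p) (ℚ.+-monoˡ-≤ (- p) p≤q)

<⇒0<- : ∀ {p q} → p < q → 0ℚ < q - p
<⇒0<- {p} {q} p<q = subst (_< q - p) (ℚ.+-inverseʳ p) (ℚ.+-monoˡ-< (- p) p<q)

p+[q-p]≡q : ∀ p q → p + (q - p) ≡ q
p+[q-p]≡q = solve-∀ ℚ-ring

0≤-⇒≤ : ∀ {p q} → 0ℚ ≤ q - p → p ≤ q
0≤-⇒≤ {p} {q} h = subst₂ _≤_ (ℚ.+-identityʳ p) (p+[q-p]≡q p q) (ℚ.+-monoʳ-≤ p h)

0<-⇒< : ∀ {p q} → 0ℚ < q - p → p < q
0<-⇒< {p} {q} h = subst₂ _<_ (ℚ.+-identityʳ p) (p+[q-p]≡q p q) (ℚ.+-monoʳ-< p h)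

neg-nonneg : ∀ {p} → p ≤ 0ℚ → 0ℚ ≤ - p
neg-nonneg = ℚ.neg-antimono-≤

neg-pos : ∀ {p} → p < 0ℚ → 0ℚ < - p
neg-pos = ℚ.neg-antimono-<

pos≢0 : ∀ {p} → 0ℚ < p → p ≢ 0ℚ
pos≢0 0<p p≡0 = ℚ.<⇒≢ 0<p (sym p≡0)

≤∧≢⇒< : ∀ {p q} → p ≤ q → p ≢ q → p < q
≤∧≢⇒< {p} {q} p≤q p≢q with p <? q
... | yes p<q = p<q
... | no  p≮q = contradiction (≤-antisym p≤q (≮⇒≥ p≮q)) p≢q

abstract
  -- `abstract` keeps the quotient opaque: later goals see a number `r` with its equation and never
  -- unfold rational division.
  inverse : ∀ p → p ≢ 0ℚ → ∃[ r ] r * p ≡ 1ℚ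
  inverse p p≢0 = (1/ p) {{≢-nonZero p≢0}} , ℚ.*-inverseˡ p {{≢-nonZero p≢0}}

abstract
  inverse-pos : ∀ {p} → 0ℚ < p → ∃[ r ] (0ℚ < r × r * p ≡ 1ℚ)
  inverse-pos {p} 0<p with inverse p (pos≢0 0<p)
  ... | r , rp≡1 = r , ≰⇒> r≰0 , rp≡1
    where
    r≰0 : ¬ r ≤ 0ℚ
    r≰0 r≤0 = ℚ.<⇒≢ (<-≤-trans 0<1 (subst₂ _≤_ rp≡1 (ℚ.*-zeroˡ p) (*-monoʳ (<⇒≤ 0<p) r≤0))) refl

neg-neg : ∀ p → - (- p) ≡ p
neg-neg = solve-∀ ℚ-ring

nonneg-neg : ∀ {p} → 0ℚ ≤ - p → p ≤ 0ℚ
nonneg-neg {p} h = subst (_≤ 0ℚ) (neg-neg p) (ℚ.neg-antimono-≤ h)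

pos-neg : ∀ {p} → 0ℚ < - p → p < 0ℚ
pos-neg {p} h = subst (_< 0ℚ) (neg-neg p) (ℚ.neg-antimono-< h)

p≤∣p∣ : ∀ p → p ≤ ∣ p ∣
p≤∣p∣ p with 0ℚ ≤? p
... | yes 0≤p = ≤-reflexive (sym (ℚ.0≤p⇒∣p∣≡p 0≤p))
... | no  0≰p = ≤-trans (<⇒≤ (≰⇒> 0≰p)) (ℚ.0≤∣p∣ p)

-∣p∣≤p : ∀ p → - ∣ p ∣ ≤ p
-∣p∣≤p p = subst (- ∣ p ∣ ≤_) (neg-neg p) (ℚ.neg-antimono-≤ (subst (- p ≤_) (ℚ.∣-p∣≡∣p∣ p) (p≤∣p∣ (- p))))
-- Finite sums

sum-cong : ∀ {k} {f g : Fin k → ℚ} → (∀ i → f i ≡ g i) → sumQ f ≡ sumQ g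
sum-cong {zero}  f≗g = refl
sum-cong {suc k} f≗g = cong₂ _+_ (f≗g zero) (sum-cong (f≗g ∘ suc))

sum-zero : ∀ {k} {f : Fin k → ℚ} → (∀ i → f i ≡ 0ℚ) → sumQ f ≡ 0ℚ
sum-zero {zero}  f≗0 = refl
sum-zero {suc k} f≗0 = trans (cong₂ _+_ (f≗0 zero) (sum-zero (f≗0 ∘ suc))) (ℚ.+-identityˡ 0ℚ)

sum-+ : ∀ {k} (f g : Fin k → ℚ) → sumQ (λ i → f i + g i) ≡ sumQ f + sumQ g
sum-+ {zero}  f g = refl
sum-+ {suc k} f g = trans (cong (f zero + g zero +_) (sum-+ (f ∘ suc) (g ∘ suc)))
                          (interchange (f zero) (g zero) _ _)
  where
  interchange : ∀ a b c d → (a + b) + (c + d) ≡ (a + c) + (b + d)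
  interchange = solve-∀ ℚ-ring

sum-* : ∀ {k} c (f : Fin k → ℚ) → sumQ (λ i → c * f i) ≡ c * sumQ f
sum-* {zero}  c f = sym (ℚ.*-zeroʳ c)
sum-* {suc k} c f = trans (cong (c * f zero +_) (sum-* c (f ∘ suc))) (sym (ℚ.*-distribˡ-+ c _ _))

sum-*ʳ : ∀ {k} c (f : Fin k → ℚ) → sumQ (λ i → f i * c) ≡ sumQ f * c
sum-*ʳ c f = trans (sum-cong (λ i → ℚ.*-comm (f i) c)) (trans (sum-* c f) (ℚ.*-comm c _))

neg≡-1* : ∀ p → - p ≡ (- 1ℚ) * p
neg≡-1* = solve-∀ ℚ-ring

sum-neg : ∀ {k} (f : Fin k → ℚ) → sumQ (λ i → - f i) ≡ - sumQ f
sum-neg f = trans (sum-cong (λ i → neg≡-1* (f i))) (trans (sum-* (- 1ℚ) f) (sym (neg≡-1* _)))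

sum-- : ∀ {k} (f g : Fin k → ℚ) → sumQ (λ i → f i - g i) ≡ sumQ f - sumQ g
sum-- f g = trans (sum-+ f (λ i → - g i)) (cong (sumQ f +_) (sum-neg g))

sum-swap : ∀ {k l} (f : Fin k → Fin l → ℚ) →
  sumQ (λ i → sumQ (λ j → f i j)) ≡ sumQ (λ j → sumQ (λ i → f i j))
sum-swap {zero}  {l} f = sym (sum-zero {l} (λ _ → refl))
sum-swap {suc k} f = trans (cong (sumQ (f zero) +_) (sum-swap (f ∘ suc)))
                           (sym (sum-+ (f zero) (λ j → sumQ (λ i → f (suc i) j))))

sum-mono : ∀ {k} {f g : Fin k → ℚ} → (∀ i → f i ≤ g i) → sumQ f ≤ sumQ g
sum-mono {zero}  f≤g = ≤-refl
sum-mono {suc k} f≤g = ℚ.+-mono-≤ (f≤g zero) (sum-mono (f≤g ∘ suc))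

sum-nonneg : ∀ {k} {f : Fin k → ℚ} → (∀ i → 0ℚ ≤ f i) → 0ℚ ≤ sumQ f
sum-nonneg {k} {f} 0≤f = subst (_≤ sumQ f) (sum-zero {k} (λ _ → refl)) (sum-mono 0≤f)

sum-single : ∀ {k} {f : Fin k → ℚ} i → (∀ j → j ≢ i → f j ≡ 0ℚ) → sumQ f ≡ f i
sum-single {suc k} {f} zero off =
  trans (cong (f zero +_) (sum-zero (λ j → off (suc j) (λ ())))) (ℚ.+-identityʳ _)
sum-single {suc k} {f} (suc i) off =
  trans (cong₂ _+_ (off zero (λ ())) (sum-single i (λ j j≢i → off (suc j) (j≢i ∘ Fin.suc-injective))))
        (ℚ.+-identityˡ _)

∣sum∣≤ : ∀ {k} (f : Fin k → ℚ) → ∣ sumQ f ∣ ≤ sumQ (λ i → ∣ f i ∣)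
∣sum∣≤ {zero}  f = ≤-refl
∣sum∣≤ {suc k} f = ≤-trans (ℚ.∣p+q∣≤∣p∣+∣q∣ (f zero) _) (ℚ.+-monoʳ-≤ ∣ f zero ∣ (∣sum∣≤ (f ∘ suc)))

term≤sum : ∀ {k} {f : Fin k → ℚ} → (∀ i → 0ℚ ≤ f i) → ∀ i → f i ≤ sumQ f
term≤sum {suc k} {f} 0≤f zero =
  subst (_≤ sumQ f) (ℚ.+-identityʳ (f zero)) (ℚ.+-monoʳ-≤ (f zero) (sum-nonneg (0≤f ∘ suc)))
term≤sum {suc k} {f} 0≤f (suc i) =
  subst (_≤ sumQ f) (ℚ.+-identityˡ (f (suc i))) (ℚ.+-mono-≤ (0≤f zero) (term≤sum (0≤f ∘ suc) i))

sum-nonneg-zero : ∀ {k} {f : Fin k → ℚ} → (∀ i → 0ℚ ≤ f i) → sumQ f ≡ 0ℚ → ∀ i → f i ≡ 0ℚ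
sum-nonneg-zero 0≤f Σ≡0 i = ≤-antisym (≤-trans (term≤sum 0≤f i) (≤-reflexive Σ≡0)) (0≤f i)

-- The embedding of ℤ

-- Operations on ℚ normalise by a gcd, so the laws of `toQ` are checked on unnormalised fractions,
-- where `toQ z` is z over 1.
toℚᵘ-toQ : ∀ z → toℚᵘ (toQ z) ℚᵘ.≃ ℚᵘ.mkℚᵘ z 0
toℚᵘ-toQ z = ℚ.toℚᵘ-fromℚᵘ (ℚᵘ.mkℚᵘ z 0)

toQ-+ : ∀ x y → toQ (x ℤ.+ y) ≡ toQ x + toQ y
toQ-+ x y = ℚ.toℚᵘ-injective (begin
  toℚᵘ (toQ (x ℤ.+ y))                    ≈⟨ toℚᵘ-toQ (x ℤ.+ y) ⟩
  ℚᵘ.mkℚᵘ (x ℤ.+ y) 0                     ≈⟨ ℚᵘ.*≡* (cong (ℤ._* ℤ.+ 1) (cong₂ ℤ._+_ (sym (ℤ.*-identityʳ x)) (sym (ℤ.*-identityʳ y)))) ⟩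
  ℚᵘ.mkℚᵘ x 0 ℚᵘ.+ ℚᵘ.mkℚᵘ y 0            ≈⟨ ℚᵘ.+-cong (toℚᵘ-toQ x) (toℚᵘ-toQ y) ⟨
  toℚᵘ (toQ x) ℚᵘ.+ toℚᵘ (toQ y)          ≈⟨ ℚ.toℚᵘ-homo-+ (toQ x) (toQ y) ⟨
  toℚᵘ (toQ x + toQ y)                    ∎)
  where open ℚᵘ.≃-Reasoning

toQ-* : ∀ x y → toQ (x ℤ.* y) ≡ toQ x * toQ y
toQ-* x y = ℚ.toℚᵘ-injective (begin
  toℚᵘ (toQ (x ℤ.* y))                    ≈⟨ toℚᵘ-toQ (x ℤ.* y) ⟩
  ℚᵘ.mkℚᵘ x 0 ℚᵘ.* ℚᵘ.mkℚᵘ y 0            ≈⟨ ℚᵘ.*-cong (toℚᵘ-toQ x) (toℚᵘ-toQ y) ⟨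
  toℚᵘ (toQ x) ℚᵘ.* toℚᵘ (toQ y)          ≈⟨ ℚ.toℚᵘ-homo-* (toQ x) (toQ y) ⟨
  toℚᵘ (toQ x * toQ y)                    ∎)
  where open ℚᵘ.≃-Reasoning

toQ-neg : ∀ x → toQ (ℤ.- x) ≡ - toQ x
toQ-neg x = ℚ.toℚᵘ-injective (begin
  toℚᵘ (toQ (ℤ.- x))    ≈⟨ toℚᵘ-toQ (ℤ.- x) ⟩
  ℚᵘ.- ℚᵘ.mkℚᵘ x 0      ≈⟨ ℚᵘ.-‿cong (toℚᵘ-toQ x) ⟨
  ℚᵘ.- toℚᵘ (toQ x)     ≈⟨ ℚ.toℚᵘ-homo‿- (toQ x) ⟨
  toℚᵘ (- toQ x)        ∎)
  where open ℚᵘ.≃-Reasoning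

toQ-mono : ∀ {x y} → x ℤ.≤ y → toQ x ≤ toQ y
toQ-mono {x} {y} x≤y = ℚ.toℚᵘ-cancel-≤ (begin
  toℚᵘ (toQ x)    ≃⟨ toℚᵘ-toQ x ⟩
  ℚᵘ.mkℚᵘ x 0     ≤⟨ ℚᵘ.*≤* (ℤ.*-monoʳ-≤-nonNeg (ℤ.+ 1) x≤y) ⟩
  ℚᵘ.mkℚᵘ y 0     ≃⟨ toℚᵘ-toQ y ⟨
  toℚᵘ (toQ y)    ∎)
  where open ℚᵘ.≤-Reasoning

toQ-injective : ∀ {x y} → toQ x ≡ toQ y → x ≡ y
toQ-injective {x} {y} eq =
  ℤ.*-cancelʳ-≡ x y (ℤ.+ 1) (ℚᵘ.drop-*≡* (ℚᵘ.≃-trans (ℚᵘ.≃-sym (toℚᵘ-toQ x)) (ℚᵘ.≃-trans (ℚ.toℚᵘ-cong eq) (toℚᵘ-toQ y))))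

toQ-cancel-≤ : ∀ {x y} → toQ x ≤ toQ y → x ℤ.≤ y
toQ-cancel-≤ {x} {y} x≤y with x ℤ.≤? y
... | yes p = p
... | no ¬p = ℤ.≤-reflexive (toQ-injective (≤-antisym x≤y (toQ-mono (ℤ.<⇒≤ (ℤ.≰⇒> ¬p)))))

-- Linear functionals on points, and nonnegative combinations of arc vectors

-- A copy of the `ind` local to `arcVec`, which is out of scope here; `arcVec≡ind-ind` is the
-- bridge.
ind : ∀ {n} → Fin n → Fin n → ℚ
ind u c with u ≟ c
... | yes _ = 1ℚ
... | no  _ = 0ℚ

ind-refl : ∀ {n} (u : Fin n) → ind u u ≡ 1ℚ
ind-refl u with u ≟ u
... | yes _   = refl
... | no  u≢u = contradiction refl u≢u

ind-≢ : ∀ {n} {u c : Fin n} → u ≢ c → ind u c ≡ 0ℚ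
ind-≢ {u = u} {c} u≢c with u ≟ c
... | yes u≡c = contradiction u≡c u≢c
... | no  _   = refl

ind-nonneg : ∀ {n} (u c : Fin n) → 0ℚ ≤ ind u c
ind-nonneg u c with u ≟ c
... | yes _ = 0≤1
... | no  _ = ≤-refl

arcVec≡ind-ind : ∀ {n} (t h c : Fin n) → arcVec t h c ≡ ind h c - ind t c
arcVec≡ind-ind t h c with h ≟ c | t ≟ c
... | yes _ | yes _ = refl
... | yes _ | no  _ = refl
... | no  _ | yes _ = refl
... | no  _ | no  _ = refl

⟪_,_⟫ : ∀ {n} → Point n → Point n → ℚ
⟪ φ , x ⟫ = sumQ (λ c → φ c * x c)

pair-cong : ∀ {n} (φ : Point n) {x y : Point n} → (∀ c → x c ≡ y c) → ⟪ φ , x ⟫ ≡ ⟪ φ , y ⟫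
pair-cong φ x≗y = sum-cong (λ c → cong (φ c *_) (x≗y c))

pair-+ : ∀ {n} (φ x y : Point n) → ⟪ φ , (λ c → x c + y c) ⟫ ≡ ⟪ φ , x ⟫ + ⟪ φ , y ⟫
pair-+ φ x y = trans (sum-cong (λ c → ℚ.*-distribˡ-+ (φ c) (x c) (y c))) (sum-+ (λ c → φ c * x c) (λ c → φ c * y c))

pair-* : ∀ {n} (φ : Point n) s (x : Point n) → ⟪ φ , (λ c → s * x c) ⟫ ≡ s * ⟪ φ , x ⟫
pair-* φ s x = trans (sum-cong (λ c → exchange (φ c) s (x c))) (sum-* s (λ c → φ c * x c))
  where
  exchange : ∀ a s b → a * (s * b) ≡ s * (a * b)
  exchange = solve-∀ ℚ-ring

pair-ind : ∀ {n} (φ : Point n) u → ⟪ φ , ind u ⟫ ≡ φ u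
pair-ind φ u = trans (sum-single u (λ c c≢u → trans (cong (φ c *_) (ind-≢ (c≢u ∘ sym))) (ℚ.*-zeroʳ (φ c))))
                     (trans (cong (φ u *_) (ind-refl u)) (ℚ.*-identityʳ (φ u)))

pair-- : ∀ {n} (φ x y : Point n) → ⟪ φ , (λ c → x c - y c) ⟫ ≡ ⟪ φ , x ⟫ - ⟪ φ , y ⟫
pair-- φ x y = trans (sum-cong (λ c → distrib (φ c) (x c) (y c))) (sum-- (λ c → φ c * x c) (λ c → φ c * y c))
  where
  distrib : ∀ a b c → a * (b - c) ≡ a * b - a * c
  distrib = solve-∀ ℚ-ring

-- A functional sees an arc only as a difference of potentials. For the indicator of a shore this is
-- the signed crossing of the cut.
pair-arcVec : ∀ {n} (φ : Point n) t h → ⟪ φ , arcVec t h ⟫ ≡ φ h - φ t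
pair-arcVec φ t h =
  trans (pair-cong φ (arcVec≡ind-ind t h)) (trans (pair-- φ (ind h) (ind t)) (cong₂ _-_ (pair-ind φ h) (pair-ind φ t)))

pair-sum : ∀ {n k} (φ : Point n) (x : Fin k → Point n) →
  ⟪ φ , (λ c → sumQ (λ i → x i c)) ⟫ ≡ sumQ (λ i → ⟪ φ , x i ⟫)
pair-sum φ x = trans (sum-cong (λ c → sym (sum-* (φ c) (λ i → x i c)))) (sum-swap (λ c i → φ c * x i c))

sum₂ : ∀ {n} → (Fin n → Fin n → ℚ) → ℚ
sum₂ f = sumQ (λ t → sumQ (f t))

sum₂-cong : ∀ {n} {f g : Fin n → Fin n → ℚ} → (∀ t h → f t h ≡ g t h) → sum₂ f ≡ sum₂ g
sum₂-cong f≗g = sum-cong (λ t → sum-cong (f≗g t))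

sum₂-zero : ∀ {n} {f : Fin n → Fin n → ℚ} → (∀ t h → f t h ≡ 0ℚ) → sum₂ f ≡ 0ℚ
sum₂-zero f≗0 = sum-zero (λ t → sum-zero (f≗0 t))

sum₂-+ : ∀ {n} (f g : Fin n → Fin n → ℚ) → sum₂ (λ t h → f t h + g t h) ≡ sum₂ f + sum₂ g
sum₂-+ f g = trans (sum-cong (λ t → sum-+ (f t) (g t))) (sum-+ (λ t → sumQ (f t)) (λ t → sumQ (g t)))

sum₂-* : ∀ {n} c (f : Fin n → Fin n → ℚ) → sum₂ (λ t h → c * f t h) ≡ c * sum₂ f
sum₂-* c f = trans (sum-cong (λ t → sum-* c (f t))) (sum-* c (λ t → sumQ (f t)))

sum₂-mono : ∀ {n} {f g : Fin n → Fin n → ℚ} → (∀ t h → f t h ≤ g t h) → sum₂ f ≤ sum₂ g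
sum₂-mono f≤g = sum-mono (λ t → sum-mono (f≤g t))

sum₂-single : ∀ {n} {f : Fin n → Fin n → ℚ} a b → (∀ t h → ¬ (t ≡ a × h ≡ b) → f t h ≡ 0ℚ) → sum₂ f ≡ f a b
sum₂-single {f = f} a b off =
  trans (sum-single a (λ t t≢a → sum-zero (λ h → off t h (t≢a ∘ proj₁))))
        (sum-single b (λ h h≢b → off a h (h≢b ∘ proj₂)))

sum₂-nonneg-zero : ∀ {n} {f : Fin n → Fin n → ℚ} → (∀ t h → 0ℚ ≤ f t h) → sum₂ f ≡ 0ℚ → ∀ t h → f t h ≡ 0ℚ
sum₂-nonneg-zero 0≤f Σ≡0 t = sum-nonneg-zero (0≤f t) (sum-nonneg-zero (λ t → sum-nonneg (0≤f t)) Σ≡0 t)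

-- Weighted representations of points by arc vectors

Support : ∀ {n} → ArcSet n → (Fin n → Fin n → ℚ) → Set
Support A λ' = ∀ t h → A t h ≡ false → λ' t h ≡ 0ℚ

comb : ∀ {n} → (Fin n → Fin n → ℚ) → Point n
comb λ' c = sumArcs λ' (λ t h → arcVec t h c)

pair-comb : ∀ {n} (φ : Point n) (λ' : Fin n → Fin n → ℚ) →
  ⟪ φ , comb λ' ⟫ ≡ sum₂ (λ t h → λ' t h * (φ h - φ t))
pair-comb φ λ' = begin
  ⟪ φ , comb λ' ⟫
    ≡⟨ pair-sum φ (λ t c → sumQ (λ h → λ' t h * arcVec t h c)) ⟩
  sumQ (λ t → ⟪ φ , (λ c → sumQ (λ h → λ' t h * arcVec t h c)) ⟫)
    ≡⟨ sum-cong (λ t → pair-sum φ (λ h c → λ' t h * arcVec t h c)) ⟩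
  sum₂ (λ t h → ⟪ φ , (λ c → λ' t h * arcVec t h c) ⟫)
    ≡⟨ sum₂-cong (λ t h → trans (pair-* φ (λ' t h) (arcVec t h)) (cong (λ' t h *_) (pair-arcVec φ t h))) ⟩
  sum₂ (λ t h → λ' t h * (φ h - φ t)) ∎
  where open ≡-Reasoning

-- Rep A x r says that x lies in r · conv (arc vectors of A), read as {0} for r = 0;
-- Rep A x 1ℚ is ConvArcs A x.
Rep : ∀ {n} → ArcSet n → Point n → ℚ → Set
Rep A x r = ∃[ λ' ]
  ((∀ t h → 0ℚ ≤ λ' t h) × Support A λ' × sumArcs λ' (λ _ _ → 1ℚ) ≡ r × ∀ c → x c ≡ comb λ' c)

rep-cong : ∀ {n} {A : ArcSet n} {x y r s} → (∀ c → x c ≡ y c) → r ≡ s → Rep A x r → Rep A y s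
rep-cong x≗y r≡s (l , 0≤l , supp , Σl , x≡) = l , 0≤l , supp , trans Σl r≡s , λ c → trans (sym (x≗y c)) (x≡ c)

rep-zero : ∀ {n} {A : ArcSet n} → Rep A (λ _ → 0ℚ) 0ℚ
rep-zero {n} = (λ _ _ → 0ℚ) , (λ _ _ → ≤-refl) , (λ _ _ _ → refl)
  , sum₂-zero {n} {λ _ _ → 0ℚ * 1ℚ} (λ _ _ → refl) , λ c → sym (sum₂-zero (λ t h → ℚ.*-zeroˡ (arcVec t h c)))

rep-+ : ∀ {n} {A : ArcSet n} {x y r s} → Rep A x r → Rep A y s → Rep A (λ c → x c + y c) (r + s)
rep-+ {x = x} {y} (l , 0≤l , suppl , Σl , x≡) (m , 0≤m , suppm , Σm , y≡) =
  (λ t h → l t h + m t h)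
  , (λ t h → +-nonneg (0≤l t h) (0≤m t h))
  , (λ t h th∉A → cong₂ _+_ (suppl t h th∉A) (suppm t h th∉A))
  , trans (dist (λ _ _ → 1ℚ)) (cong₂ _+_ Σl Σm)
  , λ c → sym (trans (dist (λ t h → arcVec t h c)) (sym (cong₂ _+_ (x≡ c) (y≡ c))))
  where
  dist : ∀ f → sumArcs (λ t h → l t h + m t h) f ≡ sumArcs l f + sumArcs m f
  dist f = trans (sum₂-cong (λ t h → ℚ.*-distribʳ-+ (f t h) (l t h) (m t h)))
                 (sum₂-+ (λ t h → l t h * f t h) (λ t h → m t h * f t h))

rep-* : ∀ {n} {A : ArcSet n} {x r s} → 0ℚ ≤ s → Rep A x r → Rep A (λ c → s * x c) (s * r)
rep-* {s = s} 0≤s (l , 0≤l , supp , Σl , x≡) =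
  (λ t h → s * l t h)
  , (λ t h → *-nonneg 0≤s (0≤l t h))
  , (λ t h th∉A → trans (cong (s *_) (supp t h th∉A)) (ℚ.*-zeroʳ s))
  , trans (scale (λ _ _ → 1ℚ)) (cong (s *_) Σl)
  , λ c → trans (cong (s *_) (x≡ c)) (sym (scale (λ t h → arcVec t h c)))
  where
  scale : ∀ f → sumArcs (λ t h → s * l t h) f ≡ s * sumArcs l f
  scale f = trans (sum₂-cong (λ t h → ℚ.*-assoc s (l t h) (f t h))) (sum₂-* s (λ t h → l t h * f t h))

rep-arc : ∀ {n} {A : ArcSet n} {a b} → A a b ≡ true → Rep A (arcVec a b) 1ℚ
rep-arc {n} {A} {a} {b} ab∈A =
  l , (λ t h → *-nonneg (ind-nonneg a t) (ind-nonneg b h)) , supp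
  , trans (at (λ _ _ → 1ℚ)) refl , λ c → sym (at (λ t h → arcVec t h c))
  where
  l : Fin n → Fin n → ℚ
  l t h = ind a t * ind b h
  off : ∀ t h → ¬ (t ≡ a × h ≡ b) → l t h ≡ 0ℚ
  off t h th≢ab with a ≟ t
  ... | no  _ = ℚ.*-zeroˡ (ind b h)
  ... | yes a≡t = trans (ℚ.*-identityˡ (ind b h)) (ind-≢ (λ b≡h → th≢ab (sym a≡t , sym b≡h)))
  supp : Support A l
  supp t h th∉A = off t h λ { (refl , refl) → case trans (sym ab∈A) th∉A of λ () }
  at : ∀ f → sumArcs l f ≡ f a b
  at f = trans (sum₂-single a b (λ t h th≢ab → trans (cong (_* f t h) (off t h th≢ab)) (ℚ.*-zeroˡ (f t h))))
    (trans (cong (_* f a b) (cong₂ _*_ (ind-refl a) (ind-refl b))) (ℚ.*-identityˡ (f a b)))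

rep-sum : ∀ {n k} {A : ArcSet n} (x : Fin k → Point n) (r : Fin k → ℚ) →
  (∀ i → Rep A (x i) (r i)) → Rep A (λ c → sumQ (λ i → x i c)) (sumQ r)
rep-sum {k = zero}  x r reps = rep-zero
rep-sum {k = suc k} x r reps = rep-+ (reps zero) (rep-sum (x ∘ suc) (r ∘ suc) (reps ∘ suc))

rep-⊆ : ∀ {n} {A B : ArcSet n} {x r} → (∀ t h → A t h ≡ true → B t h ≡ true) → Rep A x r → Rep B x r
rep-⊆ {A = A} {B} A⊆B (l , 0≤l , supp , rest) = l , 0≤l , supp′ , rest
  where
  supp′ : Support B l
  supp′ t h th∉B with A t h in eq
  ... | false = supp t h eq
  ... | true  = case trans (sym (A⊆B t h eq)) th∉B of λ ()

sumArcs-1 : ∀ {n} (l : Fin n → Fin n → ℚ) → sumArcs l (λ _ _ → 1ℚ) ≡ sum₂ l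
sumArcs-1 l = sum₂-cong (λ t h → ℚ.*-identityʳ (l t h))

rep-nonneg : ∀ {n} {A : ArcSet n} {x r} → Rep A x r → 0ℚ ≤ r
rep-nonneg (l , 0≤l , _ , Σl , _) =
  subst (0ℚ ≤_) (trans (sym (sumArcs-1 l)) Σl) (sum-nonneg (λ t → sum-nonneg (0≤l t)))

rep-0⇒0 : ∀ {n} {A : ArcSet n} {x} → Rep A x 0ℚ → ∀ c → x c ≡ 0ℚ
rep-0⇒0 (l , 0≤l , _ , Σl , x≡) c = trans (x≡ c) (sum₂-zero λ t h →
  trans (cong (_* arcVec t h c) (sum₂-nonneg-zero 0≤l (trans (sym (sumArcs-1 l)) Σl) t h)) (ℚ.*-zeroˡ (arcVec t h c)))

-- Named for its role: `total x ≡ 0ℚ` defines the hyperplane that contains all arc vectors, and by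
-- `expansion` the arcs of a spanning tree span it.
total : ∀ {n} → Point n → ℚ
total = sumQ

total-comb : ∀ {n} (l : Fin n → Fin n → ℚ) → total (comb l) ≡ 0ℚ
total-comb l = trans (sum-cong (λ c → sym (ℚ.*-identityˡ (comb l c))))
  (trans (pair-comb (λ _ → 1ℚ) l) (sum₂-zero (λ t h → ℚ.*-zeroʳ (l t h))))

rep-total : ∀ {n} {A : ArcSet n} {x r} → Rep A x r → total x ≡ 0ℚ
rep-total (l , _ , _ , _ , x≡) = trans (sum-cong x≡) (total-comb l)

arcVec-total : ∀ {n} (t h : Fin n) → total (arcVec t h) ≡ 0ℚ
arcVec-total t h = trans (sum-cong (λ c → sym (ℚ.*-identityˡ (arcVec t h c)))) (pair-arcVec (λ _ → 1ℚ) t h)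

arcVec-opp : ∀ {n} (t h c : Fin n) → arcVec h t c ≡ - arcVec t h c
arcVec-opp t h c = trans (arcVec≡ind-ind h t c)
  (trans (flip (ind t c) (ind h c)) (cong -_ (sym (arcVec≡ind-ind t h c))))
  where
  flip : ∀ a b → a - b ≡ - (b - a)
  flip = solve-∀ ℚ-ring

-- An arc and its opposite sum to zero, so half of the surplus `s - r` on each of them raises the
-- weight without moving the point. Membership in a dilate thus only bounds the weight from above.
rep-mono : ∀ {n} {A : ArcSet n} {a b} → A a b ≡ true → A b a ≡ true →
  ∀ {x r s} → Rep A x r → r ≤ s → Rep A x s
rep-mono {a = a} {b} ab∈A ba∈A {x} {r} {s} X r≤s =
  rep-cong (λ c → trans (cong (λ w → x c + ½ * (s - r) * (arcVec a b c + w)) (arcVec-opp a b c)) (cancel (x c) (½ * (s - r)) (arcVec a b c)))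
           (halves ½ r s refl)
    (rep-+ X (rep-* (*-nonneg (ℚ.nonNegative⁻¹ ½) (≤⇒0≤- r≤s)) (rep-+ (rep-arc ab∈A) (rep-arc ba∈A))))
  where
  cancel : ∀ p q v → p + q * (v + - v) ≡ p
  cancel = solve-∀ ℚ-ring
  halves′ : ∀ h r s → r + h * (s - r) * (1ℚ + 1ℚ) ≡ r + (h + h) * (s - r)
  halves′ = solve-∀ ℚ-ring
  one : ∀ r s → r + 1ℚ * (s - r) ≡ s
  one = solve-∀ ℚ-ring
  halves : ∀ h r s → h + h ≡ 1ℚ → r + h * (s - r) * (1ℚ + 1ℚ) ≡ s
  halves h r s h+h≡1 = trans (halves′ h r s) (trans (cong (λ k → r + k * (s - r)) h+h≡1) (one r s))

-- Fourier–Motzkin elimination: finitely generated cones are polyhedral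

-- The maximum of 0 and the lower bounds -α/β with β positive. The last component records which of
-- these is attained; it serves both the elimination and the minimality of the gauge.
lowest : ∀ {X : Set} (α β : X → ℚ) (xs : List X) → ∃[ s ] (0ℚ ≤ s
  × (∀ {x} → x ∈ xs → 0ℚ < β x → 0ℚ ≤ α x + s * β x)
  × (s ≡ 0ℚ ⊎ ∃[ x ] (x ∈ xs × 0ℚ < β x × α x + s * β x ≡ 0ℚ)))
lowest α β [] = 0ℚ , ≤-refl , (λ ()) , inj₁ refl
lowest α β (y ∷ ys) with lowest α β ys
... | s , 0≤s , feas , tight with 0ℚ <? β y
... | no βy≯0 = s , 0≤s , feas′ , Sum.map₂ (λ (x , x∈ , rest) → x , there x∈ , rest) tight
  where
  feas′ : ∀ {x} → x ∈ y ∷ ys → 0ℚ < β x → 0ℚ ≤ α x + s * β x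
  feas′ (here refl) 0<β = contradiction 0<β βy≯0
  feas′ (there x∈) = feas x∈
... | yes 0<βy with 0ℚ ≤? α y + s * β y
... | yes ok = s , 0≤s , feas′ , Sum.map₂ (λ (x , x∈ , rest) → x , there x∈ , rest) tight
  where
  feas′ : ∀ {x} → x ∈ y ∷ ys → 0ℚ < β x → 0ℚ ≤ α x + s * β x
  feas′ (here refl) _ = ok
  feas′ (there x∈) = feas x∈
... | no ¬ok = s′ , ≤-trans 0≤s s≤s′ , feas′ , inj₂ (y , here refl , 0<βy , tight-y)
  where
  r = proj₁ (inverse-pos 0<βy)
  s′ = - α y * r
  tight-y : α y + s′ * β y ≡ 0ℚ
  tight-y = trans (regroup (α y) r (β y))
    (trans (cong (λ w → α y - α y * w) (proj₂ (proj₂ (inverse-pos 0<βy)))) (cancel (α y)))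
    where
    regroup : ∀ a r b → a + (- a * r) * b ≡ a - a * (r * b)
    regroup = solve-∀ ℚ-ring
    cancel : ∀ a → a - a * 1ℚ ≡ 0ℚ
    cancel = solve-∀ ℚ-ring
  s≤s′ : s ≤ s′
  s≤s′ = *-cancel-≤ 0<βy (0≤-⇒≤ (subst (0ℚ ≤_) (shift (α y) s s′ (β y) tight-y) (neg-nonneg (<⇒≤ (≰⇒> ¬ok)))))
    where
    shift′ : ∀ a s t b → - (a + s * b) + (a + t * b) ≡ b * t - b * s
    shift′ = solve-∀ ℚ-ring
    shift : ∀ a s t b → a + t * b ≡ 0ℚ → - (a + s * b) ≡ b * t - b * s
    shift a s t b eq = trans (sym (trans (cong (- (a + s * b) +_) eq) (ℚ.+-identityʳ _))) (shift′ a s t b)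
  feas′ : ∀ {x} → x ∈ y ∷ ys → 0ℚ < β x → 0ℚ ≤ α x + s′ * β x
  feas′ (here refl) _ = ≤-reflexive (sym tight-y)
  feas′ {x} (there x∈) 0<β = ≤-trans (feas x∈ 0<β) (ℚ.+-monoʳ-≤ (α x) (*-monoʳ (<⇒≤ 0<β) s≤s′))

-- Recursion on the generators isolates one coefficient at a time, which is the variable that
-- elimination removes.
Cone : ∀ {n} → List (Point n) → Point n → Set
Cone []      p = ∀ i → p i ≡ 0ℚ
Cone (a ∷ L) p = ∃[ s ] (0ℚ ≤ s × Cone L (λ i → p i - s * a i))

cone-cong : ∀ {n} (L : List (Point n)) {p q} → (∀ i → p i ≡ q i) → Cone L p → Cone L q
cone-cong []      p≗q K i = trans (sym (p≗q i)) (K i)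
cone-cong (a ∷ L) p≗q (s , 0≤s , K) = s , 0≤s , cone-cong L (λ i → cong (_- s * a i) (p≗q i)) K

cone-zero : ∀ {n} (L : List (Point n)) → Cone L (λ _ → 0ℚ)
cone-zero []      i = refl
cone-zero (a ∷ L) = 0ℚ , ≤-refl , cone-cong L (λ i → zeros (a i)) (cone-zero L)
  where
  zeros : ∀ v → 0ℚ ≡ 0ℚ - 0ℚ * v
  zeros = solve-∀ ℚ-ring

cone-+ : ∀ {n} (L : List (Point n)) {p q} → Cone L p → Cone L q → Cone L (λ i → p i + q i)
cone-+ []      K D i = trans (cong₂ _+_ (K i) (D i)) (ℚ.+-identityˡ 0ℚ)
cone-+ (a ∷ L) {p} {q} (s , 0≤s , K) (t , 0≤t , D) =
  s + t , +-nonneg 0≤s 0≤t , cone-cong L (λ i → regroup (p i) (q i) s t (a i)) (cone-+ L K D)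
  where
  regroup : ∀ p q s t a → (p - s * a) + (q - t * a) ≡ (p + q) - (s + t) * a
  regroup = solve-∀ ℚ-ring

cone-* : ∀ {n} (L : List (Point n)) {p r} → 0ℚ ≤ r → Cone L p → Cone L (λ i → r * p i)
cone-* []      {r = r} 0≤r K i = trans (cong (r *_) (K i)) (ℚ.*-zeroʳ r)
cone-* (a ∷ L) {p} {r} 0≤r (s , 0≤s , K) =
  r * s , *-nonneg 0≤r 0≤s , cone-cong L (λ i → regroup r (p i) s (a i)) (cone-* L 0≤r K)
  where
  regroup : ∀ r p s a → r * (p - s * a) ≡ r * p - (r * s) * a
  regroup = solve-∀ ℚ-ring

cone-generator : ∀ {n} {L : List (Point n)} {a} → a ∈ L → Cone L a
cone-generator {L = a ∷ L} (here refl) = 1ℚ , 0≤1 , cone-cong L (λ i → cancel (a i)) (cone-zero L)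
  where
  cancel : ∀ v → 0ℚ ≡ v - 1ℚ * v
  cancel = solve-∀ ℚ-ring
cone-generator {L = b ∷ L} {a} (there a∈L) =
  0ℚ , ≤-refl , cone-cong L (λ i → drop (a i) (b i)) (cone-generator a∈L)
  where
  drop : ∀ v w → v ≡ v - 0ℚ * w
  drop = solve-∀ ℚ-ring

cone-sum : ∀ {n k} (L : List (Point n)) (p : Fin k → Point n) →
  (∀ j → Cone L (p j)) → Cone L (λ i → sumQ (λ j → p j i))
cone-sum {k = zero}  L p K = cone-zero L
cone-sum {k = suc k} L p K = cone-+ L (K zero) (cone-sum L (p ∘ suc) (K ∘ suc))

pair-combˡ : ∀ {n} u v (h k p : Point n) → ⟪ (λ i → u * h i - v * k i) , p ⟫ ≡ u * ⟪ h , p ⟫ - v * ⟪ k , p ⟫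
pair-combˡ u v h k p =
  trans (sum-cong (λ i → distrib u v (h i) (k i) (p i)))
  (trans (sum-- (λ i → u * (h i * p i)) (λ i → v * (k i * p i)))
    (cong₂ _-_ (sum-* u (λ i → h i * p i)) (sum-* v (λ i → k i * p i))))
  where
  distrib : ∀ u v h k p → (u * h - v * k) * p ≡ u * (h * p) - v * (k * p)
  distrib = solve-∀ ℚ-ring

pair-shift : ∀ {n} (h p a : Point n) s → ⟪ h , (λ i → p i - s * a i) ⟫ ≡ ⟪ h , p ⟫ - s * ⟪ h , a ⟫
pair-shift h p a s = trans (pair-- h p (λ i → s * a i)) (cong (λ w → ⟪ h , p ⟫ - w) (pair-* h s a))

-- The condition ⟪h,p⟫ - s⟪h,a⟫ ≥ 0 bounds `s` from below if `h` is in `neg`, from above if it is in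
-- `pos`, and does not involve `s` if ⟪h,a⟫ = 0. Eliminating `s` pairs each lower bound with each
-- upper bound by `combine`. The bound s ≥ 0 paired with an upper bound gives back `h` itself, which
-- is why `nonneg` keeps the members of `pos` too.
module Eliminate {n} (a : Point n) (H : List (Point n)) where

  nonneg neg pos : List (Point n)
  nonneg = filter (λ h → 0ℚ ≤? ⟪ h , a ⟫) H
  neg    = filter (λ h → ⟪ h , a ⟫ <? 0ℚ) H
  pos    = filter (λ h → 0ℚ <? ⟪ h , a ⟫) H

  combine : Point n × Point n → Point n
  combine (h , k) i = ⟪ k , a ⟫ * h i - ⟪ h , a ⟫ * k i

  eliminated : List (Point n)
  eliminated = nonneg ++ map combine (cartesianProduct neg pos)

  sound : ∀ {p s} → 0ℚ ≤ s → (∀ {h} → h ∈ H → 0ℚ ≤ ⟪ h , (λ i → p i - s * a i) ⟫) →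
    ∀ {h} → h ∈ eliminated → 0ℚ ≤ ⟪ h , p ⟫
  sound {p} {s} 0≤s feas {h} h∈ with ∈-++⁻ nonneg h∈
  ... | inj₁ h∈nonneg with ∈-filter⁻ (λ h → 0ℚ ≤? ⟪ h , a ⟫) {xs = H} h∈nonneg
  ... | h∈H , 0≤ha = subst (0ℚ ≤_) (trans (cong (_+ s * ⟪ h , a ⟫) (pair-shift h p a s)) (restore ⟪ h , p ⟫ (s * ⟪ h , a ⟫)))
                       (+-nonneg (feas h∈H) (*-nonneg 0≤s 0≤ha))
    where
    restore : ∀ u v → (u - v) + v ≡ u
    restore = solve-∀ ℚ-ring
  sound {p} {s} 0≤s feas h∈ | inj₂ h∈comb with ∈-map⁻ combine h∈comb
  ... | (h , k) , hk∈ , refl with ∈-cartesianProduct⁻ neg pos hk∈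
  ... | h∈neg , k∈pos with ∈-filter⁻ (λ h → ⟪ h , a ⟫ <? 0ℚ) {xs = H} h∈neg | ∈-filter⁻ (λ h → 0ℚ <? ⟪ h , a ⟫) {xs = H} k∈pos
  ... | h∈H , ha<0 | k∈H , 0<ka =
    subst (0ℚ ≤_)
      (trans (cong₂ (λ u v → ⟪ k , a ⟫ * u + - ⟪ h , a ⟫ * v) (pair-shift h p a s) (pair-shift k p a s))
        (trans (regroup ⟪ h , p ⟫ ⟪ k , p ⟫ ⟪ h , a ⟫ ⟪ k , a ⟫ s) (sym (pair-combˡ ⟪ k , a ⟫ ⟪ h , a ⟫ h k p))))
      (+-nonneg (*-nonneg (<⇒≤ 0<ka) (feas h∈H)) (*-nonneg (neg-nonneg (<⇒≤ ha<0)) (feas k∈H)))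
    where
    regroup : ∀ hp kp ha ka s → ka * (hp - s * ha) + - ha * (kp - s * ka) ≡ ka * hp - ha * kp
    regroup = solve-∀ ℚ-ring

  complete : ∀ {p} → (∀ {h} → h ∈ eliminated → 0ℚ ≤ ⟪ h , p ⟫) →
    ∃[ s ] (0ℚ ≤ s × ∀ {h} → h ∈ H → 0ℚ ≤ ⟪ h , (λ i → p i - s * a i) ⟫)
  complete {p} feas = s , 0≤s , λ {h} h∈H → subst (0ℚ ≤_) (sym (pair-shift h p a s)) (ok h∈H)
    where
    -- The least `s` that meets all lower bounds; the sign turns ⟪h,a⟫ < 0 into a positive slope.
    low = lowest (λ h → ⟪ h , p ⟫) (λ h → - ⟪ h , a ⟫) H
    s = proj₁ low
    0≤s = proj₁ (proj₂ low)
    to- : ∀ x s y → x + s * - y ≡ x - s * y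
    to- = solve-∀ ℚ-ring
    factor : ∀ hp ha kp ka s → kp + s * - ka ≡ 0ℚ → ha * kp - ka * hp ≡ - ka * (hp - s * ha)
    factor hp ha kp ka s eq = trans (expand hp ha kp ka s) (trans (cong (λ w → ha * w + - ka * (hp - s * ha)) eq) (drop ha _))
      where
      expand : ∀ hp ha kp ka s → ha * kp - ka * hp ≡ ha * (kp + s * - ka) + - ka * (hp - s * ha)
      expand = solve-∀ ℚ-ring
      drop : ∀ u v → u * 0ℚ + v ≡ v
      drop = solve-∀ ℚ-ring
    pair-zero : ∀ hp ha s → ha ≡ 0ℚ → hp ≡ hp - s * ha
    pair-zero hp ha s refl = drop hp s
      where
      drop : ∀ u s → u ≡ u - s * 0ℚ
      drop = solve-∀ ℚ-ring
    ok : ∀ {h} → h ∈ H → 0ℚ ≤ ⟪ h , p ⟫ - s * ⟪ h , a ⟫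
    ok {h} h∈H with 0ℚ ≤? ⟪ h , a ⟫
    ... | no 0≰ha = subst (0ℚ ≤_) (to- ⟪ h , p ⟫ s ⟪ h , a ⟫) (proj₁ (proj₂ (proj₂ low)) h∈H (neg-pos (≰⇒> 0≰ha)))
    -- An upper bound is compared with whatever determined `s`: the constraint s ≥ 0, or a tight
    -- lower bound `k`, whose combination with `h` is among the eliminated inequalities.
    ... | yes 0≤ha with proj₂ (proj₂ (proj₂ low))
    ... | inj₁ s≡0 = subst (λ s → 0ℚ ≤ ⟪ h , p ⟫ - s * ⟪ h , a ⟫) (sym s≡0)
                       (subst (0ℚ ≤_) (drop ⟪ h , p ⟫ ⟪ h , a ⟫) (feas (∈-++⁺ˡ (∈-filter⁺ (λ h → 0ℚ ≤? ⟪ h , a ⟫) h∈H 0≤ha))))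
      where
      drop : ∀ u v → u ≡ u - 0ℚ * v
      drop = solve-∀ ℚ-ring
    ... | inj₂ (k , k∈H , 0<-ka , tight) with ⟪ h , a ⟫ ℚ.≟ 0ℚ
    ... | yes ha≡0 = subst (0ℚ ≤_) (pair-zero ⟪ h , p ⟫ ⟪ h , a ⟫ s ha≡0) (feas (∈-++⁺ˡ (∈-filter⁺ (λ h → 0ℚ ≤? ⟪ h , a ⟫) h∈H 0≤ha)))
    ... | no ha≢0 = *-cancel-≤ 0<-ka (subst₂ _≤_ (sym (ℚ.*-zeroʳ (- ⟪ k , a ⟫)))
            (trans (pair-combˡ ⟪ h , a ⟫ ⟪ k , a ⟫ k h p) (factor ⟪ h , p ⟫ ⟪ h , a ⟫ ⟪ k , p ⟫ ⟪ k , a ⟫ s tight))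
            (feas (∈-++⁺ʳ nonneg (∈-map⁺ combine
              (∈-cartesianProduct⁺ (∈-filter⁺ (λ h → ⟪ h , a ⟫ <? 0ℚ) k∈H ka<0)
                                   (∈-filter⁺ (λ h → 0ℚ <? ⟪ h , a ⟫) h∈H (≤∧≢⇒< 0≤ha (ha≢0 ∘ sym))))))))
      where
      ka<0 : ⟪ k , a ⟫ < 0ℚ
      ka<0 = pos-neg 0<-ka

polyhedral : ∀ {n} (L : List (Point n)) → ∃[ H ] ∀ p →
  (Cone L p → ∀ {h} → h ∈ H → 0ℚ ≤ ⟪ h , p ⟫) × ((∀ {h} → h ∈ H → 0ℚ ≤ ⟪ h , p ⟫) → Cone L p)
polyhedral {n} [] = H , λ p → fwd p , bwd p
  where
  coord -coord : Fin n → Point n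
  coord = ind
  -coord i c = - ind i c
  -- The cone on no generators is the origin, cut out by both signs of every coordinate.
  H = map coord (allFin n) ++ map -coord (allFin n)
  coord-pair : ∀ p i → ⟪ coord i , p ⟫ ≡ p i
  coord-pair p i = trans (sum-cong (λ c → ℚ.*-comm (ind i c) (p c))) (pair-ind p i)
  -coord-pair : ∀ p i → ⟪ -coord i , p ⟫ ≡ - p i
  -coord-pair p i = trans (sum-cong (λ c → sym (ℚ.neg-distribˡ-* (ind i c) (p c))))
    (trans (sum-neg (λ c → ind i c * p c)) (cong -_ (coord-pair p i)))
  fwd : ∀ p → (∀ i → p i ≡ 0ℚ) → ∀ {h} → h ∈ H → 0ℚ ≤ ⟪ h , p ⟫
  fwd p p≗0 {h} _ = ≤-reflexive (sym (sum-zero (λ i → trans (cong (h i *_) (p≗0 i)) (ℚ.*-zeroʳ (h i)))))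
  bwd : ∀ p → (∀ {h} → h ∈ H → 0ℚ ≤ ⟪ h , p ⟫) → ∀ i → p i ≡ 0ℚ
  bwd p feas i = ≤-antisym
    (nonneg-neg (subst (0ℚ ≤_) (-coord-pair p i) (feas (∈-++⁺ʳ (map coord (allFin n)) (∈-map⁺ -coord (∈-allFin i))))))
    (subst (0ℚ ≤_) (coord-pair p i) (feas (∈-++⁺ˡ (∈-map⁺ coord (∈-allFin i)))))
polyhedral (a ∷ L) with polyhedral L
... | H , iff = eliminated
  , λ p → (λ (s , 0≤s , K) → sound {p} 0≤s (proj₁ (iff _) K))
        , (λ feas → let (s , 0≤s , ok) = complete {p} feas in s , 0≤s , proj₂ (iff _) ok)
  where open Eliminate a H

-- Homogenisation: since every generator has 1 in coordinate `zero`, that coordinate of a cone point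
-- records the sum of its coefficients, so `Rep A x r` becomes membership of `extend r x` in a cone.
extend : ∀ {n} → ℚ → Point n → Point (suc n)
extend r x zero    = r
extend r x (suc c) = x c

module _ {n} (A : ArcSet n) where

  arcs : List (Fin n × Fin n)
  arcs = filter (λ (t , h) → A t h Bool.≟ true) (cartesianProduct (allFin n) (allFin n))

  ∈-arcs⁺ : ∀ {t h} → A t h ≡ true → (t , h) ∈ arcs
  ∈-arcs⁺ {t} {h} th∈A = ∈-filter⁺ (λ (t , h) → A t h Bool.≟ true) (∈-cartesianProduct⁺ (∈-allFin t) (∈-allFin h)) th∈A

  ∈-arcs⁻ : ∀ {t h} → (t , h) ∈ arcs → A t h ≡ true
  ∈-arcs⁻ th∈ = proj₂ (∈-filter⁻ (λ (t , h) → A t h Bool.≟ true) {xs = cartesianProduct (allFin n) (allFin n)} th∈)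

  generator : Fin n × Fin n → Point (suc n)
  generator (t , h) = extend 1ℚ (arcVec t h)

  cone⇒rep : ∀ as → (∀ {t h} → (t , h) ∈ as → A t h ≡ true) → ∀ {p} →
    Cone (map generator as) p → Rep A (p ∘ suc) (p zero)
  cone⇒rep [] as⊆A K = rep-cong (λ c → sym (K (suc c))) (sym (K zero)) rep-zero
  cone⇒rep ((t , h) ∷ as) as⊆A {p} (s , 0≤s , K) =
    rep-cong (λ c → restore (p (suc c)) (s * arcVec t h c)) (restore (p zero) (s * 1ℚ))
      (rep-+ (cone⇒rep as (as⊆A ∘ there) K) (rep-* 0≤s (rep-arc (as⊆A (here refl)))))
    where
    restore : ∀ u v → (u - v) + v ≡ u
    restore = solve-∀ ℚ-ring

  rep⇒cone : ∀ {x r} → Rep A x r → Cone (map generator arcs) (extend r x)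
  rep⇒cone {x} {r} (l , 0≤l , supp , Σl , x≡) =
    cone-cong L agree (cone-sum L _ (λ t → cone-sum L _ (λ h → term t h)))
    where
    L = map generator arcs
    term : ∀ t h → Cone L (λ i → l t h * generator (t , h) i)
    term t h with A t h in eq
    ... | true  = cone-* L (0≤l t h) (cone-generator (∈-map⁺ generator (∈-arcs⁺ eq)))
    ... | false = cone-cong L (λ i → sym (trans (cong (_* generator (t , h) i) (supp t h eq)) (ℚ.*-zeroˡ (generator (t , h) i)))) (cone-zero L)
    agree : ∀ i → sum₂ (λ t h → l t h * generator (t , h) i) ≡ extend r x i
    agree zero    = Σl
    agree (suc c) = sym (x≡ c)

  -- By polyhedrality {r ∣ Rep A x r} is cut out by finitely many inequalities, so it has a minimum.
  rep-min : ∀ {x r} → Rep A x r → ∃[ r₀ ] (Rep A x r₀ × ∀ {s} → Rep A x s → r₀ ≤ s)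
  rep-min {x} {r} X = r₀ , cone⇒rep arcs ∈-arcs⁻ (proj₂ (iff (extend r₀ x)) feasible) , minimal
    where
    H = proj₁ (polyhedral (map generator arcs))
    iff = proj₂ (polyhedral (map generator arcs))
    -- With `x` fixed, each inequality of the cone is affine in the weight: α h + r β h ≥ 0.
    α β : Point (suc n) → ℚ
    α h = ⟪ h ∘ suc , x ⟫
    β h = h zero
    low = lowest α β H
    r₀ = proj₁ low
    swap : ∀ s h → ⟪ h , extend s x ⟫ ≡ α h + s * β h
    swap s h = comm (β h) s (α h)
      where
      comm : ∀ b s a → b * s + a ≡ a + s * b
      comm = solve-∀ ℚ-ring
    holds : ∀ {s} → Rep A x s → ∀ {h} → h ∈ H → 0ℚ ≤ α h + s * β h
    holds {s} S {h} h∈H = subst (0ℚ ≤_) (swap s h) (proj₁ (iff (extend s x)) (rep⇒cone S) h∈H)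
    minimal : ∀ {s} → Rep A x s → r₀ ≤ s
    minimal {s} S with proj₂ (proj₂ (proj₂ low))
    ... | inj₁ r₀≡0 = subst (_≤ s) (sym r₀≡0) (rep-nonneg S)
    ... | inj₂ (h , h∈H , 0<β , tight) = *-cancel-≤ 0<β (0≤-⇒≤ (subst (0ℚ ≤_) (shift (α h) s r₀ (β h) tight) (holds S h∈H)))
      where
      shift′ : ∀ a s t b → (a + s * b) - (a + t * b) ≡ b * s - b * t
      shift′ = solve-∀ ℚ-ring
      shift : ∀ a s t b → a + t * b ≡ 0ℚ → a + s * b ≡ b * s - b * t
      shift a s t b eq = trans (sym (trans (cong (λ w → (a + s * b) - w) eq) (ℚ.+-identityʳ _))) (shift′ a s t b)
    feasible : ∀ {h} → h ∈ H → 0ℚ ≤ ⟪ h , extend r₀ x ⟫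
    feasible {h} h∈H with 0ℚ <? β h
    ... | yes 0<β = subst (0ℚ ≤_) (sym (swap r₀ h)) (proj₁ (proj₂ (proj₂ low)) h∈H 0<β)
    -- An inequality with nonpositive slope holds at `r`, and passing from `r` down to `r₀`
    -- preserves it.
    ... | no β≯0 = subst (0ℚ ≤_) (sym (swap r₀ h)) (≤-trans (holds X h∈H) (ℚ.+-monoʳ-≤ (α h)
            (ℚ.*-monoʳ-≤-nonPos (β h) {{nonPositive (≮⇒≥ β≯0)}} (minimal X))))

-- Fundamental cuts of a spanning tree

Reach : ∀ {n} → (Fin n → Fin n → Set) → Fin n → Fin n → Set
Reach R u v = ∃[ ws ] Walk R u ws v

reach-refl : ∀ {n R} {u : Fin n} → Reach R u u
reach-refl = [] , stop

reach-step : ∀ {n R} {u v : Fin n} → R u v → Reach R u v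
reach-step r = _ , step r stop

reach-trans : ∀ {n R} {u v w : Fin n} → Reach R u v → Reach R v w → Reach R u w
reach-trans (_ , stop)      q = q
reach-trans (_ , step r rs) q = _ , step r (proj₂ (reach-trans (_ , rs) q))

reach-sym : ∀ {n R} → (∀ {u v : Fin n} → R u v → R v u) → ∀ {u v} → Reach R u v → Reach R v u
reach-sym R-sym (_ , stop)      = reach-refl
reach-sym R-sym (_ , step r rs) = reach-trans (reach-sym R-sym (_ , rs)) (reach-step (R-sym r))

Path : ∀ {n} → (Fin n → Fin n → Set) → Fin n → Fin n → Set
Path R u v = ∃[ ws ] (Walk R u ws v × Unique (u ∷ ws))

path-suffix : ∀ {n R} {u v w : Fin n} {ws} → Walk R w ws v → Unique (w ∷ ws) → u ∈ w ∷ ws → Path R u v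
path-suffix p           uniq       (here refl)  = _ , p , uniq
path-suffix (step r rs) (_ ∷ uniq) (there u∈ws) = path-suffix rs uniq u∈ws

-- Loop erasure: if the new start already lies on the path, only the suffix from there is kept.
-- `HasCycle` asks for distinct vertices, so a bare walk would not contradict acyclicity.
walk⇒path : ∀ {n R} {u v : Fin n} {ws} → Walk R u ws v → Path R u v
walk⇒path stop = [] , stop , [] ∷ []
walk⇒path {u = u} (step {w = w} r rs) with walk⇒path rs
... | ws , p , uniq with Any.any? (u ≟_) (w ∷ ws)
... | yes u∈ = path-suffix p uniq u∈
... | no  u∉ = w ∷ ws , step r p , ¬Any⇒All¬ (w ∷ ws) u∉ ∷ uniq

walk-map : ∀ {n} {R S : Fin n → Fin n → Set} → (∀ {u v} → R u v → S u v) → ∀ {u ws v} → Walk R u ws v → Walk S u ws v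
walk-map f stop        = stop
walk-map f (step r rs) = step (f r) (walk-map f rs)

walk-last : ∀ {n R} {u v w : Fin n} {ws} → Walk R u (w ∷ ws) v → List.last (w ∷ ws) ≡ just v
walk-last (step _ stop)        = refl
walk-last (step _ (step r rs)) = walk-last (step r rs)

indicator : Bool → ℚ
indicator true  = 1ℚ
indicator false = 0ℚ

module Cut {n} (T : ArcSet n) (oriented : ∀ u v → T u v ≡ true → T v u ≡ false)
  (tree : IsSpanningTree (Und T)) {a b : Fin n} (ab∈T : T a b ≡ true) where

  UndMinus-sym : ∀ {u v} → UndMinus T a b u v → UndMinus T a b v u
  UndMinus-sym (uv , uv≢ab) = Sum.swap uv , λ where
    (inj₁ (v≡a , u≡b)) → uv≢ab (inj₂ (u≡b , v≡a))
    (inj₂ (v≡b , u≡a)) → uv≢ab (inj₁ (u≡a , v≡b))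

  -- A path from `a` to `b` that avoids the edge would close up with it to a cycle. Paths with fewer
  -- than two steps are too short for `HasCycle`: the empty one makes the arc a loop, against
  -- orientedness, and a single step would be the removed edge.
  separated : ¬ InShore T a b a b
  separated (_ , p) with walk⇒path p
  ... | [] , stop , _ = case trans (sym ab∈T) (oriented a a ab∈T) of λ ()
  ... | _ ∷ [] , step (_ , ≢ab) stop , _ = ≢ab (inj₁ (refl , refl))
  ... | ws@(_ ∷ _ ∷ _) , q , uniq =
    proj₂ tree (a , ws , b , s≤s (s≤s z≤n) , uniq , walk-last q , walk-map proj₁ q , inj₂ ab∈T)

  Shored : Fin n → Set
  Shored w = InShore T a b a w ⊎ InShore T a b b w

  -- A step along the removed edge ends at `a` or `b`, which starts its own shore; any other step
  -- stays in the shore.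
  shored-step : ∀ {u w} → Und T u w → Shored u → Shored w
  shored-step {u} {w} uw s with u ≟ a ×-dec w ≟ b | u ≟ b ×-dec w ≟ a
  ... | yes (_ , refl) | _              = inj₂ reach-refl
  ... | no _           | yes (_ , refl) = inj₁ reach-refl
  ... | no ≢ab         | no ≢ba         = Sum.map extendTo extendTo s
    where
    extendTo : ∀ {x} → InShore T a b x u → InShore T a b x w
    extendTo p = reach-trans p (reach-step (uw , [ ≢ab , ≢ba ]′))

  shored-walk : ∀ {u ws w} → Walk (Und T) u ws w → Shored u → Shored w
  shored-walk stop        s = s
  shored-walk (step r rs) s = shored-walk rs (shored-step r s)

  shored : ∀ w → Shored w
  shored w = shored-walk (proj₂ (proj₁ tree a w)) (inj₁ reach-refl)

  -- Following a walk of the tree from `a` yields a Boolean without deciding reachability. By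
  -- `separated` it does not depend on the walk; `true` is the shore of the head.
  side : Fin n → Bool
  side w = [ (λ _ → false) , (λ _ → true) ]′ (shored w)

  side-true : ∀ {w} → side w ≡ true → InShore T a b b w
  side-true {w} eq with shored w
  ... | inj₂ p = p

  side-false : ∀ {w} → side w ≡ false → InShore T a b a w
  side-false {w} eq with shored w
  ... | inj₁ p = p

  head-shore : ∀ {w} → InShore T a b b w → side w ≡ true
  head-shore {w} p with shored w
  ... | inj₁ q = contradiction (reach-trans q (reach-sym UndMinus-sym p)) separated
  ... | inj₂ _ = refl

  tail-shore : ∀ {w} → InShore T a b a w → side w ≡ false
  tail-shore {w} p with shored w
  ... | inj₁ _ = refl
  ... | inj₂ q = contradiction (reach-trans p (reach-sym UndMinus-sym q)) separated

  side-const : ∀ {u w} → UndMinus T a b u w → side u ≡ side w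
  side-const {u} {w} r with side u in eq
  ... | true  = sym (head-shore (reach-trans (side-true eq) (reach-step r)))
  ... | false = sym (tail-shore (reach-trans (side-false eq) (reach-step r)))

-- The arc vectors of an oriented spanning tree and the dual basis given by its fundamental cuts

arcs-unique : ∀ {n} (A : ArcSet n) → Unique (arcs A)
arcs-unique {n} A = Unique.filter⁺ (λ (t , h) → A t h Bool.≟ true)
  (Unique.cartesianProduct⁺ (Unique.allFin⁺ n) (Unique.allFin⁺ n))

lookup-injective : ∀ {A : Set} {xs : List A} → Unique xs → ∀ i j → List.lookup xs i ≡ List.lookup xs j → i ≡ j
lookup-injective (_ ∷ _)   zero    zero    eq = refl
lookup-injective (≢x ∷ _)  zero    (suc j) eq = contradiction eq (All.lookup ≢x (∈-lookup j))
lookup-injective (≢x ∷ _)  (suc i) zero    eq = contradiction (sym eq) (All.lookup ≢x (∈-lookup i))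
lookup-injective (_ ∷ uniq) (suc i) (suc j) eq = cong suc (lookup-injective uniq i j eq)

-- Uniform bounds for small perturbations

norm : ∀ {n} → Point n → ℚ
norm x = sumQ (λ c → ∣ x c ∣)

norm-nonneg : ∀ {n} (x : Point n) → 0ℚ ≤ norm x
norm-nonneg x = sum-nonneg (λ c → ℚ.0≤∣p∣ (x c))

sum-const : ∀ k e → sumQ {k} (λ _ → e) ≡ sumQ {k} (λ _ → 1ℚ) * e
sum-const k e = trans (sum-cong {k} (λ _ → sym (ℚ.*-identityˡ e))) (sum-*ʳ {k} e (λ _ → 1ℚ))

count : ℕ → ℚ
count k = sumQ {k} (λ _ → 1ℚ)

count-nonneg : ∀ k → 0ℚ ≤ count k
count-nonneg k = sum-nonneg {k} {λ _ → 1ℚ} (λ _ → 0≤1)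

abstract
  -- The witness is m / (1 + k), where the extra 1 covers k = 0.
  scale-down : ∀ k {m} → 0ℚ < m → ∃[ ε ] (0ℚ < ε × sumQ {k} (λ _ → ε) ≤ m)
  scale-down k {m} 0<m = from (inverse-pos {1ℚ + count k} (ℚ.+-mono-<-≤ 0<1 (count-nonneg k)))
    where
    absorb : ∀ u r m → m - u * (m * r) ≡ m * (1ℚ - u * r)
    absorb = solve-∀ ℚ-ring
    remainder : ∀ u r → 1ℚ - u * r ≡ r + (1ℚ - r * (1ℚ + u))
    remainder = solve-∀ ℚ-ring
    from : ∃[ r ] (0ℚ < r × r * (1ℚ + count k) ≡ 1ℚ) → ∃[ ε ] (0ℚ < ε × sumQ {k} (λ _ → ε) ≤ m)
    from (r , 0<r , r[1+k]≡1) = m * r , *-pos 0<m 0<r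
      , 0≤-⇒≤ (subst (0ℚ ≤_) (sym slack) (*-nonneg (<⇒≤ 0<m) (<⇒≤ 0<r)))
      where
      slack : m - sumQ {k} (λ _ → m * r) ≡ m * r
      slack = begin
        m - sumQ {k} (λ _ → m * r)          ≡⟨ cong (λ w → m - w) (sum-const k (m * r)) ⟩
        m - count k * (m * r)               ≡⟨ absorb (count k) r m ⟩
        m * (1ℚ - count k * r)              ≡⟨ cong (m *_) (remainder (count k) r) ⟩
        m * (r + (1ℚ - r * (1ℚ + count k))) ≡⟨ cong (λ w → m * (r + (1ℚ - w))) r[1+k]≡1 ⟩
        m * (r + 0ℚ)                        ≡⟨ cong (m *_) (ℚ.+-identityʳ r) ⟩
        m * r                               ∎
        where open ≡-Reasoning

small-ball : ∀ n {m} → 0ℚ < m → ∃[ ε ] (0ℚ < ε × ∀ (w : Point n) → (∀ c → ∣ w c ∣ < ε) → norm w ≤ m)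
small-ball n 0<m with scale-down n 0<m
... | ε , 0<ε , nε≤m = ε , 0<ε , λ w small → ≤-trans (sum-mono {f = λ c → ∣ w c ∣} {λ _ → ε} (λ c → <⇒≤ (small c))) nε≤m

lower-bound : ∀ {k} (f : Fin k → ℚ) → (∀ i → 0ℚ < f i) → ∃[ m ] (0ℚ < m × ∀ i → m ≤ f i)
lower-bound {zero}  f 0<f = 1ℚ , 0<1 , λ ()
lower-bound {suc k} f 0<f with lower-bound (f ∘ suc) (0<f ∘ suc)
... | m , 0<m , m≤f with ℚ.≤-total m (f zero)
... | inj₁ m≤f₀ = m , 0<m , λ { zero → m≤f₀ ; (suc i) → m≤f i }
... | inj₂ f₀≤m = f zero , 0<f zero , λ { zero → ≤-refl ; (suc i) → ≤-trans f₀≤m (m≤f i) }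

module Tree {n} (T : ArcSet n) (oriented : ∀ u v → T u v ≡ true → T v u ≡ false)
  (tree : IsSpanningTree (Und T)) where

  N : ℕ
  N = length (arcs T)

  tl hd : Fin N → Fin n
  tl k = proj₁ (List.lookup (arcs T) k)
  hd k = proj₂ (List.lookup (arcs T) k)

  inT : ∀ k → T (tl k) (hd k) ≡ true
  inT k = ∈-arcs⁻ T (∈-lookup k)

  arc-injective : ∀ {k l} → tl k ≡ tl l → hd k ≡ hd l → k ≡ l
  arc-injective tl≡ hd≡ = lookup-injective (arcs-unique T) _ _ (cong₂ _,_ tl≡ hd≡)

  index : ∀ {t h} → T t h ≡ true → ∃[ k ] (tl k ≡ t × hd k ≡ h)
  index th∈T = Any.index th∈ , cong proj₁ (sym (lookup-index th∈)) , cong proj₂ (sym (lookup-index th∈))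
    where th∈ = ∈-arcs⁺ T th∈T

  module At (k : Fin N) = Cut T oriented tree (inT k)

  basis : Fin N → Point n
  basis k = arcVec (tl k) (hd k)

  -- The indicator of the head shore of a fundamental cut. Arc `k` is the only arc of the tree that
  -- crosses this cut, so these functionals are dual to `basis`, and they are integral.
  dual : Fin N → Point n
  dual k w = indicator (At.side k w)

  coord : Fin N → Point n → ℚ
  coord k x = ⟪ dual k , x ⟫

  dual-hd : ∀ k → dual k (hd k) ≡ 1ℚ
  dual-hd k = cong indicator (At.head-shore k reach-refl)

  dual-tl : ∀ k → dual k (tl k) ≡ 0ℚ
  dual-tl k = cong indicator (At.tail-shore k reach-refl)

  dual-other : ∀ k {t h} → T t h ≡ true → ¬ (t ≡ tl k × h ≡ hd k) → dual k h - dual k t ≡ 0ℚ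
  dual-other k {t} {h} th∈T ≢k = trans (cong (λ s → dual k h - indicator s)
      (At.side-const k (inj₁ th∈T , [ ≢k , reversed ]′))) (ℚ.+-inverseʳ (dual k h))
    where
    reversed : ¬ (t ≡ hd k × h ≡ tl k)
    reversed (refl , refl) = case trans (sym (oriented _ _ th∈T)) (inT k) of λ ()

  coord-comb : ∀ k {l} → Support T l → coord k (comb l) ≡ l (tl k) (hd k)
  coord-comb k {l} supp = trans (pair-comb (dual k) l)
    (trans (sum₂-single (tl k) (hd k) off)
      (trans (cong₂ (λ p q → l (tl k) (hd k) * (p - q)) (dual-hd k) (dual-tl k)) (ℚ.*-identityʳ (l (tl k) (hd k)))))
    where
    off : ∀ t h → ¬ (t ≡ tl k × h ≡ hd k) → l t h * (dual k h - dual k t) ≡ 0ℚ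
    off t h ≢k with T t h in eq
    ... | true  = trans (cong (l t h *_) (dual-other k eq ≢k)) (ℚ.*-zeroʳ (l t h))
    ... | false = trans (cong (_* (dual k h - dual k t)) (supp t h eq)) (ℚ.*-zeroˡ (dual k h - dual k t))

  coord-basis : ∀ k l → coord k (basis l) ≡ ind l k
  coord-basis k l with l ≟ k
  ... | yes refl = trans (pair-arcVec (dual k) (tl k) (hd k)) (cong₂ _-_ (dual-hd k) (dual-tl k))
  ... | no  l≢k  = trans (pair-arcVec (dual k) (tl l) (hd l))
                     (dual-other k (inT l) (λ (tl≡ , hd≡) → l≢k (arc-injective tl≡ hd≡)))

  spanned : (Fin N → ℚ) → Point n
  spanned s c = sumQ (λ k → s k * basis k c)

  coord-spanned : ∀ k s → coord k (spanned s) ≡ s k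
  coord-spanned k s = trans (pair-sum (dual k) (λ l c → s l * basis l c))
    (trans (sum-cong (λ l → trans (pair-* (dual k) (s l) (basis l)) (cong (s l *_) (coord-basis k l))))
      (trans (sum-single k (λ l l≢k → trans (cong (s l *_) (ind-≢ l≢k)) (ℚ.*-zeroʳ (s l))))
        (trans (cong (s k *_) (ind-refl k)) (ℚ.*-identityʳ (s k)))))

  Expands : Point n → Set
  Expands x = ∀ c → x c ≡ spanned (λ k → coord k x) c

  expands-cong : ∀ {x y} → (∀ c → x c ≡ y c) → Expands x → Expands y
  expands-cong x≗y X c = trans (sym (x≗y c)) (trans (X c)
    (sum-cong (λ k → cong (_* basis k c) (pair-cong (dual k) x≗y))))

  expands-+ : ∀ {x y} → Expands x → Expands y → Expands (λ c → x c + y c)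
  expands-+ {x} {y} X Y c = trans (cong₂ _+_ (X c) (Y c))
    (trans (sym (sum-+ (λ k → coord k x * basis k c) (λ k → coord k y * basis k c)))
      (sum-cong (λ k → trans (sym (ℚ.*-distribʳ-+ (basis k c) (coord k x) (coord k y)))
                             (cong (_* basis k c) (sym (pair-+ (dual k) x y))))))

  expands-* : ∀ {x} s → Expands x → Expands (λ c → s * x c)
  expands-* {x} s X c = trans (cong (s *_) (X c))
    (trans (sym (sum-* s (λ k → coord k x * basis k c)))
      (sum-cong (λ k → trans (sym (ℚ.*-assoc s (coord k x) (basis k c)))
                             (cong (_* basis k c) (sym (pair-* (dual k) s x))))))

  expands-zero : Expands (λ _ → 0ℚ)
  expands-zero c = sym (sum-zero (λ k → trans (cong (_* basis k c) (sum-zero (λ w → ℚ.*-zeroʳ (dual k w)))) (ℚ.*-zeroˡ (basis k c))))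

  expands-sum : ∀ {m} (x : Fin m → Point n) → (∀ i → Expands (x i)) → Expands (λ c → sumQ (λ i → x i c))
  expands-sum {zero}  x X = expands-zero
  expands-sum {suc m} x X = expands-+ (X zero) (expands-sum (x ∘ suc) (X ∘ suc))

  expands-basis : ∀ l → Expands (basis l)
  expands-basis l c = sym (trans
    (sum-single l (λ k k≢l → trans (cong (_* basis k c) (trans (coord-basis k l) (ind-≢ (k≢l ∘ sym)))) (ℚ.*-zeroˡ (basis k c))))
    (trans (cong (_* basis l c) (trans (coord-basis l l) (ind-refl l))) (ℚ.*-identityˡ (basis l c))))

  expands-arc : ∀ {t h} → T t h ≡ true → Expands (arcVec t h)
  expands-arc th∈T with index th∈T
  ... | k , refl , refl = expands-basis k

  expands-walk : ∀ {u ws v} → Walk (Und T) u ws v → Expands (arcVec u v)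
  expands-walk {u} stop = expands-cong (λ c → sym (trans (arcVec≡ind-ind u u c) (ℚ.+-inverseʳ (ind u c)))) expands-zero
  expands-walk {u} {v = v} (step {w = w} r rs) =
    expands-cong (λ c → trans (cong₂ _+_ (arcVec≡ind-ind u w c) (arcVec≡ind-ind w v c))
                   (trans (chain (ind u c) (ind w c) (ind v c)) (sym (arcVec≡ind-ind u v c))))
      (expands-+ (edge r) (expands-walk rs))
    where
    chain : ∀ a b c → (b - a) + (c - b) ≡ c - a
    chain = solve-∀ ℚ-ring
    edge : Und T u w → Expands (arcVec u w)
    edge (inj₁ uw∈T) = expands-arc uw∈T
    edge (inj₂ wu∈T) = expands-cong (λ c → trans (sym (neg≡-1* (arcVec w u c))) (sym (arcVec-opp w u c))) (expands-* (- 1ℚ) (expands-arc wu∈T))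

  -- If the entries sum to zero, x is the sum of x u (1_u - 1_root), and each difference telescopes
  -- along a walk in the tree. The coordinate `c` under inspection serves as root, which also
  -- supplies a vertex.
  expansion : ∀ {x} → total x ≡ 0ℚ → Expands x
  expansion {x} Σx≡0 c = expands-cong from-root
      (expands-sum (λ u c′ → x u * arcVec c u c′) (λ u → expands-* (x u) (expands-walk (proj₂ (proj₁ tree c u))))) c
    where
    distrib : ∀ s p q → s * (p - q) ≡ s * p - s * q
    distrib = solve-∀ ℚ-ring
    vanish : ∀ p q → p - 0ℚ * q ≡ p
    vanish = solve-∀ ℚ-ring
    from-root : ∀ c′ → sumQ (λ u → x u * arcVec c u c′) ≡ x c′
    from-root c′ = begin
      sumQ (λ u → x u * arcVec c u c′)
        ≡⟨ sum-cong (λ u → trans (cong (x u *_) (arcVec≡ind-ind c u c′)) (distrib (x u) (ind u c′) (ind c c′))) ⟩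
      sumQ (λ u → x u * ind u c′ - x u * ind c c′)
        ≡⟨ sum-- (λ u → x u * ind u c′) (λ u → x u * ind c c′) ⟩
      sumQ (λ u → x u * ind u c′) - sumQ (λ u → x u * ind c c′)
        ≡⟨ cong₂ _-_ (sum-single c′ (λ u u≢c′ → trans (cong (x u *_) (ind-≢ u≢c′)) (ℚ.*-zeroʳ (x u)))) (sum-*ʳ (ind c c′) x) ⟩
      x c′ * ind c′ c′ - sumQ x * ind c c′
        ≡⟨ cong₂ (λ p q → p - q * ind c c′) (trans (cong (x c′ *_) (ind-refl c′)) (ℚ.*-identityʳ (x c′))) Σx≡0 ⟩
      x c′ - 0ℚ * ind c c′
        ≡⟨ vanish (x c′) (ind c c′) ⟩
      x c′ ∎
      where open ≡-Reasoning

  -- `dual k` takes only the values 0 and 1, so the bound depends on neither the arc nor the tree.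
  -- The uniform choice of `M` rests on this.
  ∣coord∣≤norm : ∀ k x → ∣ coord k x ∣ ≤ norm x
  ∣coord∣≤norm k x = ≤-trans (∣sum∣≤ (λ c → dual k c * x c)) (sum-mono term)
    where
    term : ∀ c → ∣ dual k c * x c ∣ ≤ ∣ x c ∣
    term c with At.side k c
    ... | true  = ≤-reflexive (cong ∣_∣ (ℚ.*-identityˡ (x c)))
    ... | false = ≤-trans (≤-reflexive (cong ∣_∣ (ℚ.*-zeroˡ (x c)))) (ℚ.0≤∣p∣ (x c))

  rep⇒coord : ∀ {x r} → Rep T x r → ∀ k → 0ℚ ≤ coord k x
  rep⇒coord (l , 0≤l , supp , _ , x≡) k =
    subst (0ℚ ≤_) (sym (trans (pair-cong (dual k) x≡) (coord-comb k supp))) (0≤l (tl k) (hd k))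

  -- On the cone of a tree of the dissection this is the gauge, by `size-minimal`.
  size : Point n → ℚ
  size x = sumQ (λ k → coord k x)

  coord⇒rep : ∀ {x} → total x ≡ 0ℚ → (∀ k → 0ℚ ≤ coord k x) → Rep T x (size x)
  coord⇒rep {x} Σx≡0 0≤x = rep-cong (λ c → sym (expansion Σx≡0 c)) (sum-cong (λ k → ℚ.*-identityʳ (coord k x)))
    (rep-sum (λ k c → coord k x * basis k c) (λ k → coord k x * 1ℚ) (λ k → rep-* (0≤x k) (rep-arc (inT k))))

  -- All coordinates of x are at least some m > 0, and a small enough move changes each by at most
  -- m. The coefficients of an affine combination of tree arcs are its coordinates, so they stay
  -- nonnegative.
  interior : ∀ {x} → total x ≡ 0ℚ → (∀ k → 0ℚ < coord k x) → size x ≡ 1ℚ → RelInt T x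
  interior {x} Σx≡0 0<x size≡1 with lower-bound (λ k → coord k x) 0<x
  ... | m , 0<m , m≤x with small-ball n 0<m
  ... | ε , 0<ε , ball = rep-cong (λ _ → refl) size≡1 (coord⇒rep Σx≡0 (<⇒≤ ∘ 0<x)) , ε , 0<ε , near
    where
    near : ∀ z → AffArcs T z → (∀ c → ∣ z c - x c ∣ < ε) → ConvArcs T z
    near z (μ , supp , Σμ , z≡) close = μ , 0≤μ , supp , Σμ , z≡
      where
      0≤z : ∀ k → 0ℚ ≤ coord k z
      0≤z k = subst (0ℚ ≤_) (trans (cong (coord k x +_) (pair-- (dual k) z x)) (p+[q-p]≡q (coord k x) (coord k z)))
        (≤-trans (≤⇒0≤- (≤-trans (∣coord∣≤norm k _) (≤-trans (ball _ close) (m≤x k))))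
                 (ℚ.+-monoʳ-≤ (coord k x) (-∣p∣≤p (coord k (λ c → z c - x c)))))
      0≤μ : ∀ t h → 0ℚ ≤ μ t h
      0≤μ t h with T t h in eq
      ... | false = ≤-reflexive (sym (supp t h eq))
      ... | true with index eq
      ... | k , refl , refl = subst (0ℚ ≤_) (trans (pair-cong (dual k) z≡) (coord-comb k supp)) (0≤z k)

-- The gauge of the symmetric edge polytope and its dissections

∣∣-neg : ∀ {p} → p ≤ 0ℚ → ∣ p ∣ ≡ - p
∣∣-neg {p} p≤0 = trans (sym (ℚ.∣-p∣≡∣p∣ p)) (ℚ.0≤p⇒∣p∣≡p (neg-nonneg p≤0))

unscale : ∀ s r → s * r ≡ 1ℚ → ∀ v → r * (s * v) ≡ v
unscale s r sr≡1 v = trans (regroup s r v) (trans (cong (_* v) sr≡1) (ℚ.*-identityˡ v))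
  where
  regroup : ∀ s r v → r * (s * v) ≡ s * r * v
  regroup = solve-∀ ℚ-ring

total-* : ∀ {n} s {x : Point n} → total x ≡ 0ℚ → total (λ c → s * x c) ≡ 0ℚ
total-* s {x} Σx≡0 = trans (sum-* s x) (trans (cong (s *_) Σx≡0) (ℚ.*-zeroʳ s))

module Polytope {n} (G : SimpleGraph n) where

  A : ArcSet n
  A = adj G

  A-sym : ∀ {u v} → A u v ≡ true → A v u ≡ true
  A-sym = adj-sym G _ _

  arc≢0 : ∀ {a b} → A a b ≡ true → arcVec a b b ≢ 0ℚ
  arc≢0 {a} {b} ab∈G eq = ℚ.1≢0 (trans (sym value) eq)
    where
    a≢b : a ≢ b
    a≢b refl = case trans (sym ab∈G) (loopless G a) of λ ()
    value : arcVec a b b ≡ 1ℚ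
    value = trans (arcVec≡ind-ind a b b) (cong₂ _-_ (ind-refl b) (ind-≢ a≢b))

  rep-signed : ∀ {a b} → A a b ≡ true → ∀ s → Rep A (λ c → s * arcVec a b c) ∣ s ∣
  rep-signed {a} {b} ab∈G s with 0ℚ ≤? s
  ... | yes 0≤s = rep-cong (λ _ → refl) (trans (ℚ.*-identityʳ s) (sym (ℚ.0≤p⇒∣p∣≡p 0≤s))) (rep-* 0≤s (rep-arc ab∈G))
  ... | no  0≰s = rep-cong (λ c → trans (cong (- s *_) (arcVec-opp a b c)) (neg*neg s (arcVec a b c)))
                           (trans (ℚ.*-identityʳ (- s)) (sym (∣∣-neg s≤0)))
                           (rep-* (neg-nonneg s≤0) (rep-arc (A-sym ab∈G)))
    where
    s≤0 = <⇒≤ (≰⇒> 0≰s)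
    neg*neg : ∀ s v → - s * - v ≡ s * v
    neg*neg = solve-∀ ℚ-ring

  -- The tree serves only as a basis. The displacement z - x expands over its arcs, and a
  -- coefficient s costs weight |s| because both orientations are available; for z near x the total
  -- cost fits into the spare weight 1 - r.
  slack⇒relInt : ∀ {T} → IsOrientedSpanningTree G T → ∀ {a b} → A a b ≡ true →
    ∀ {x r} → Rep A x r → r < 1ℚ → RelInt A x
  slack⇒relInt {T} (T⊆G , oriented , tree) ab∈G {x} {r} X r<1 =
    from (scale-down N (<⇒0<- r<1))
    where
    open Tree T oriented tree
    from : ∃[ ε ] (0ℚ < ε × sumQ {N} (λ _ → ε) ≤ 1ℚ - r) → RelInt A x
    from (ε , 0<ε , Nε≤1-r) with small-ball n 0<ε
    ... | δ , 0<δ , ball = rep-mono ab∈G (A-sym ab∈G) X (<⇒≤ r<1) , δ , 0<δ , near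
      where
      near : ∀ z → AffArcs A z → (∀ c → ∣ z c - x c ∣ < δ) → ConvArcs A z
      near z (μ , _ , _ , z≡) close =
        rep-mono ab∈G (A-sym ab∈G)
          (rep-cong (λ c → trans (cong (x c +_) (sym (expansion w-total c))) (p+[q-p]≡q (x c) (z c))) refl
            (rep-+ X (rep-sum (λ k c → coord k w * basis k c) (λ k → ∣ coord k w ∣) (λ k → rep-signed (T⊆G _ _ (inT k)) (coord k w)))))
          (subst (r + sumQ (λ k → ∣ coord k w ∣) ≤_) (p+[q-p]≡q r 1ℚ) (ℚ.+-monoʳ-≤ r small))
        where
        w : Point n
        w c = z c - x c
        w-total : total w ≡ 0ℚ
        w-total = trans (sum-- z x) (cong₂ _-_ (trans (sum-cong z≡) (total-comb μ)) (rep-total X))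
        small : sumQ (λ k → ∣ coord k w ∣) ≤ 1ℚ - r
        small = ≤-trans (sum-mono {f = λ k → ∣ coord k w ∣} {λ _ → ε} (λ k → ≤-trans (∣coord∣≤norm k w) (ball w close))) Nε≤1-r

  -- If x is relatively interior, then (1 + δ) x is still in the polytope for small δ > 0, and
  -- dividing by 1 + δ leaves weight 1 / (1 + δ) for x.
  relInt⇒slack : ∀ {a b} → A a b ≡ true → ∀ {x} → RelInt A x → ∃[ r ] (r < 1ℚ × Rep A x r)
  relInt⇒slack ab∈G {x} (X@(l , _ , suppl , Σl , x≡) , ε , 0<ε , near) =
    from (inverse-pos (ℚ.+-mono-<-≤ 0<1 (norm-nonneg x)))
    where
    from : ∃[ s ] (0ℚ < s × s * (1ℚ + norm x) ≡ 1ℚ) → ∃[ r ] (r < 1ℚ × Rep A x r)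
    from (s , 0<s , s[1+norm]≡1) = from′ (inverse-pos 0<1+δ)
      where
      -- Here δ = ε / (1 + norm x), which makes δ |x c| < ε for every coordinate.
      δ : ℚ
      δ = ε * s
      0<δ : 0ℚ < δ
      0<δ = *-pos 0<ε 0<s
      0<1+δ : 0ℚ < 1ℚ + δ
      0<1+δ = ℚ.+-mono-<-≤ 0<1 (<⇒≤ 0<δ)
      z : Point n
      z c = (1ℚ + δ) * x c
      -- Scaling makes the coefficients sum to 1 + δ. Subtracting a representation of the origin of
      -- weight δ restores the affine condition without moving z.
      padding : Rep A (λ _ → 0ℚ) δ
      padding = rep-mono ab∈G (A-sym ab∈G) rep-zero (<⇒≤ 0<δ)
      m = proj₁ padding
      μ : Fin n → Fin n → ℚ
      μ t h = (1ℚ + δ) * l t h + - 1ℚ * m t h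
      expand : ∀ f → sumArcs μ f ≡ (1ℚ + δ) * sumArcs l f + - 1ℚ * sumArcs m f
      expand f = trans (sum₂-cong (λ t h → distrib (1ℚ + δ) (l t h) (m t h) (f t h)))
        (trans (sum₂-+ (λ t h → (1ℚ + δ) * (l t h * f t h)) (λ t h → - 1ℚ * (m t h * f t h)))
          (cong₂ _+_ (sum₂-* (1ℚ + δ) (λ t h → l t h * f t h)) (sum₂-* (- 1ℚ) (λ t h → m t h * f t h))))
        where
        distrib : ∀ u l m f → (u * l + - 1ℚ * m) * f ≡ u * (l * f) + - 1ℚ * (m * f)
        distrib = solve-∀ ℚ-ring
      z∈aff : AffArcs A z
      z∈aff = μ
        , (λ t h th∉G → trans (cong₂ (λ p q → (1ℚ + δ) * p + - 1ℚ * q) (suppl t h th∉G) (proj₁ (proj₂ (proj₂ padding)) t h th∉G)) (vanish δ))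
        , trans (expand (λ _ _ → 1ℚ)) (trans (cong₂ (λ p q → (1ℚ + δ) * p + - 1ℚ * q) Σl (proj₁ (proj₂ (proj₂ (proj₂ padding))))) (unit δ))
        , λ c → sym (trans (expand (λ t h → arcVec t h c))
            (trans (cong₂ (λ p q → (1ℚ + δ) * p + - 1ℚ * q) (sym (x≡ c)) (sym (proj₂ (proj₂ (proj₂ (proj₂ padding))) c))) (drop ((1ℚ + δ) * x c))))
        where
        vanish : ∀ δ → (1ℚ + δ) * 0ℚ + - 1ℚ * 0ℚ ≡ 0ℚ
        vanish = solve-∀ ℚ-ring
        unit : ∀ δ → (1ℚ + δ) * 1ℚ + - 1ℚ * δ ≡ 1ℚ
        unit = solve-∀ ℚ-ring
        drop : ∀ v → v + - 1ℚ * 0ℚ ≡ v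
        drop = solve-∀ ℚ-ring
      close : ∀ c → ∣ z c - x c ∣ < ε
      close c = ≤-<-trans (≤-reflexive step₁)
        (≤-<-trans (*-monoˡ (<⇒≤ 0<δ) (term≤sum (λ c → ℚ.0≤∣p∣ (x c)) c))
          (0<-⇒< (subst (0ℚ <_) step₂ 0<δ)))
        where
        difference : ∀ δ v → (1ℚ + δ) * v - v ≡ δ * v
        difference = solve-∀ ℚ-ring
        step₁ : ∣ z c - x c ∣ ≡ δ * ∣ x c ∣
        step₁ = trans (cong ∣_∣ (difference δ (x c)))
          (trans (ℚ.∣p*q∣≡∣p∣*∣q∣ δ (x c)) (cong (_* ∣ x c ∣) (ℚ.0≤p⇒∣p∣≡p (<⇒≤ 0<δ))))
        regroup : ∀ e s v → e * s ≡ e * (s * (1ℚ + v)) - e * s * v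
        regroup = solve-∀ ℚ-ring
        step₂ : δ ≡ ε - δ * norm x
        step₂ = trans (regroup ε s (norm x)) (cong (λ w → w - δ * norm x) (trans (cong (ε *_) s[1+norm]≡1) (ℚ.*-identityʳ ε)))
      from′ : ∃[ u ] (0ℚ < u × u * (1ℚ + δ) ≡ 1ℚ) → ∃[ r ] (r < 1ℚ × Rep A x r)
      from′ (u , 0<u , u[1+δ]≡1) = u * 1ℚ
        , 0<-⇒< (subst (0ℚ <_) (trans (split u δ) (cong (λ w → w - u * 1ℚ) u[1+δ]≡1)) (*-pos 0<u 0<δ))
        , rep-cong (λ c → trans (sym (ℚ.*-assoc u (1ℚ + δ) (x c))) (trans (cong (_* x c) u[1+δ]≡1) (ℚ.*-identityˡ (x c)))) refl
            (rep-* (<⇒≤ 0<u) (near z z∈aff close))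
        where
        split : ∀ u δ → u * δ ≡ u * (1ℚ + δ) - u * 1ℚ
        split = solve-∀ ℚ-ring

  minimal⇒boundary : ∀ {a b} → A a b ≡ true → ∀ {x} → Rep A x 1ℚ → (∀ {s} → Rep A x s → 1ℚ ≤ s) → Boundary A x
  minimal⇒boundary ab∈G X minimal = X , λ int → let (r , r<1 , R) = relInt⇒slack ab∈G int in
    ℚ.<⇒≢ (<-≤-trans r<1 (minimal R)) refl

  boundary⇒minimal : ∀ {T} → IsOrientedSpanningTree G T → ∀ {a b} → A a b ≡ true →
    ∀ {x s} → Boundary A x → Rep A x s → 1ℚ ≤ s
  boundary⇒minimal isT ab∈G (_ , not-int) S = ≮⇒≥ (λ s<1 → not-int (slack⇒relInt isT ab∈G S s<1))

-- Cones over the simplices of a dissection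

module Dissection {n m} (G : SimpleGraph n) (𝒯 : Fin m → ArcSet n) (dissecting : DissectingTreeSet G 𝒯)
  {a b} (ab∈G : adj G a b ≡ true) where

  open Polytope G

  isTree : ∀ j → IsOrientedSpanningTree G (𝒯 j)
  isTree = proj₁ dissecting

  module Tr (j : Fin m) = Tree (𝒯 j) (proj₁ (proj₂ (isTree j))) (proj₂ (proj₂ (isTree j)))

  InCone : Point n → Fin m → Set
  InCone x j = ∀ k → 0ℚ ≤ Tr.coord j k x

  rep-tree⇒rep : ∀ j {x r} → Rep (𝒯 j) x r → Rep A x r
  rep-tree⇒rep j = rep-⊆ (proj₁ (isTree j))

  -- The dissection covers only the boundary, so x is divided by its gauge, and the signs of the
  -- coordinates survive the scaling.
  covered-by-minimum : ∀ {x r} → 0ℚ < r → Rep A x r → (∀ {s} → Rep A x s → r ≤ s) → ∃[ j ] InCone x j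
  covered-by-minimum {x} {r} 0<r X minimal = from (inverse-pos 0<r)
    where
    from : ∃[ s ] (0ℚ < s × s * r ≡ 1ℚ) → ∃[ j ] InCone x j
    from (s , 0<s , sr≡1) = conclude (Equivalence.to (proj₂ (proj₂ (proj₂ dissecting)) (λ c → s * x c))
        (minimal⇒boundary ab∈G (rep-cong (λ _ → refl) sr≡1 (rep-* (<⇒≤ 0<s) X)) λ {t} Y →
          *-cancel-≤ 0<r (subst (_≤ r * t) (sym (ℚ.*-identityʳ r))
            (minimal (rep-cong (λ c → unscale s r sr≡1 (x c)) refl (rep-* (<⇒≤ 0<r) Y))))))
      where
      conclude : ∃[ j ] ConvArcs (𝒯 j) (λ c → s * x c) → ∃[ j ] InCone x j
      conclude (j , Y) = j , λ k → subst (0ℚ ≤_)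
        (trans (cong (r *_) (pair-* (Tr.dual j k) s x)) (unscale s r sr≡1 (Tr.coord j k x)))
        (*-nonneg (<⇒≤ 0<r) (Tr.rep⇒coord j Y k))

  -- The origin lies in every cone but cannot be scaled to gauge 1, so `covered` needs an index from
  -- elsewhere. A nonzero arc vector has positive gauge and provides one.
  some-tree : Fin m
  some-tree = from (rep-min A (rep-arc ab∈G))
    where
    from : ∃[ r ] (Rep A (arcVec a b) r × (∀ {s} → Rep A (arcVec a b) s → r ≤ s)) → Fin m
    from (r , X , minimal) = proj₁ (covered-by-minimum
      (≤∧≢⇒< (rep-nonneg X) (λ 0≡r → arc≢0 ab∈G (rep-0⇒0 (rep-cong (λ _ → refl) (sym 0≡r) X) b))) X minimal)

  covered : ∀ {x r} → Rep A x r → ∃[ j ] InCone x j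
  covered {x} X = from (rep-min A X)
    where
    from : ∃[ r ] (Rep A x r × (∀ {s} → Rep A x s → r ≤ s)) → ∃[ j ] InCone x j
    from (r , R , minimal) with 0ℚ <? r
    ... | yes 0<r = covered-by-minimum 0<r R minimal
    ... | no  0≮r = some-tree , λ k → ≤-reflexive (sym (sum-zero (λ c →
            trans (cong (Tr.dual some-tree k c *_) (rep-0⇒0 (rep-cong (λ _ → refl) (≤-antisym (≮⇒≥ 0≮r) (rep-nonneg R)) R) c))
                  (ℚ.*-zeroʳ (Tr.dual some-tree k c)))))

  tree-boundary : ∀ j {x} → Rep (𝒯 j) x 1ℚ → Boundary A x
  tree-boundary j {x} X = Equivalence.from (proj₂ (proj₂ (proj₂ dissecting)) x) (j , X)

  -- Scaled to size 1, x lies in a simplex of the dissection and hence on the boundary, where no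
  -- representation has weight below 1.
  size-minimal : ∀ j {x s} → total x ≡ 0ℚ → InCone x j → Rep A x s → Tr.size j x ≤ s
  size-minimal j {x} {s} Σx≡0 x∈j X with 0ℚ <? Tr.size j x
  ... | no  0≮S = ≤-trans (≮⇒≥ 0≮S) (rep-nonneg X)
  ... | yes 0<S = from (inverse-pos 0<S)
    where
    from : ∃[ u ] (0ℚ < u × u * Tr.size j x ≡ 1ℚ) → Tr.size j x ≤ s
    from (u , 0<u , uS≡1) = *-cancel-≤ 0<u (subst (_≤ u * s) (sym uS≡1)
      (boundary⇒minimal (isTree j) ab∈G
        (tree-boundary j (rep-cong (λ _ → refl) uS≡1 (rep-* (<⇒≤ 0<u) (Tr.coord⇒rep j Σx≡0 x∈j))))
        (rep-* (<⇒≤ 0<u) X)))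

  -- Positive coordinates can only sum to zero if there are none; a tree without arcs would make the
  -- nonzero vector of `ab` expand to zero.
  size-positive : ∀ j {x} → total x ≡ 0ℚ → (∀ k → 0ℚ < Tr.coord j k x) → 0ℚ < Tr.size j x
  size-positive j {x} Σx≡0 0<x = ≰⇒> λ S≤0 →
    let S≡0 = ≤-antisym S≤0 (sum-nonneg (<⇒≤ ∘ 0<x)) in
    arc≢0 ab∈G (trans (Tr.expansion j (arcVec-total a b) b)
      (sum-zero (λ k → contradiction (sum-nonneg-zero (<⇒≤ ∘ 0<x) S≡0 k) (pos≢0 (0<x k)))))

  -- Both sizes are the gauge of x, so the same factor brings x into the relative interiors of both
  -- simplices.
  interior-disjoint : ∀ {j j′ x} → total x ≡ 0ℚ → (∀ k → 0ℚ < Tr.coord j k x) → (∀ k → 0ℚ < Tr.coord j′ k x) → j ≡ j′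
  interior-disjoint {j} {j′} {x} Σx≡0 0<x 0<x′ = from (inverse-pos (size-positive j Σx≡0 0<x))
    where
    sizes≡ : Tr.size j x ≡ Tr.size j′ x
    sizes≡ = ≤-antisym
      (size-minimal j  Σx≡0 (<⇒≤ ∘ 0<x)  (rep-tree⇒rep j′ (Tr.coord⇒rep j′ Σx≡0 (<⇒≤ ∘ 0<x′))))
      (size-minimal j′ Σx≡0 (<⇒≤ ∘ 0<x′) (rep-tree⇒rep j  (Tr.coord⇒rep j  Σx≡0 (<⇒≤ ∘ 0<x))))
    scaled : ∀ i u → 0ℚ < u → (∀ k → 0ℚ < Tr.coord i k x) → u * Tr.size i x ≡ 1ℚ → RelInt (𝒯 i) (λ c → u * x c)
    scaled i u 0<u 0<x uS≡1 = Tr.interior i (total-* u {x} Σx≡0)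
      (λ k → subst (0ℚ <_) (sym (pair-* (Tr.dual i k) u x)) (*-pos 0<u (0<x k)))
      (trans (sum-cong (λ k → pair-* (Tr.dual i k) u x)) (trans (sum-* u (λ k → Tr.coord i k x)) uS≡1))
    from : ∃[ u ] (0ℚ < u × u * Tr.size j x ≡ 1ℚ) → j ≡ j′
    from (u , 0<u , uS≡1) = decidable-stable (j ≟ j′) λ j≢j′ →
      proj₁ (proj₂ (proj₂ dissecting)) j j′ j≢j′ (λ c → u * x c)
        (scaled j u 0<u 0<x uS≡1 , scaled j′ u 0<u 0<x′ (trans (cong (u *_) (sym sizes≡)) uS≡1))

-- A generic direction whose coordinate signs detect semi-passivity

maximum-in : ∀ {X : Set} (f : X → ℕ) {x} {xs : List X} → x ∈ xs → ∃[ y ] (y ∈ xs × ∀ {z} → z ∈ xs → f z ℕ.≤ f y)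
maximum-in f {xs = y ∷ []} _ = y , here refl , λ { (here refl) → ℕ.≤-refl }
maximum-in f {xs = y ∷ ys@(_ ∷ _)} _ with maximum-in f {xs = ys} (here refl)
... | m , m∈ , max with ℕ.≤-total (f y) (f m)
... | inj₁ y≤m = m , there m∈ , λ { (here refl) → y≤m ; (there z∈) → max z∈ }
... | inj₂ m≤y = y , here refl , λ { (here refl) → ℕ.≤-refl ; (there z∈) → ℕ.≤-trans (max z∈) m≤y }

module Direction {n} (G : SimpleGraph n) (rank : Fin n → Fin n → ℕ) (order : IsArcOrder G rank) where

  -- One more than the number of ordered pairs of vertices, so that a power of `W` outweighs the sum
  -- of all terms of lower rank.
  W : ℚ
  W = 1ℚ + count n * count n

  n²<W : count n * count n < W
  n²<W = subst (_< W) (ℚ.+-identityˡ _) (ℚ.+-monoˡ-< (count n * count n) 0<1)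

  1≤W : 1ℚ ≤ W
  1≤W = subst (_≤ W) (ℚ.+-identityʳ 1ℚ) (ℚ.+-monoʳ-≤ 1ℚ (*-nonneg (count-nonneg n) (count-nonneg n)))

  0<W : 0ℚ < W
  0<W = <-≤-trans 0<1 1≤W

  pow : ℕ → ℚ
  pow zero    = 1ℚ
  pow (suc r) = W * pow r

  pow-pos : ∀ r → 0ℚ < pow r
  pow-pos zero    = 0<1
  pow-pos (suc r) = *-pos 0<W (pow-pos r)

  pow-mono : ∀ {r s} → r ℕ.≤ s → pow r ≤ pow s
  pow-mono {s = s} z≤n = 1≤pow s
    where
    1≤pow : ∀ s → 1ℚ ≤ pow s
    1≤pow zero    = ≤-refl
    1≤pow (suc s) = ≤-trans 1≤W (subst (_≤ W * pow s) (ℚ.*-identityʳ W) (*-monoˡ (<⇒≤ 0<W) (1≤pow s)))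
  pow-mono (s≤s r≤s) = *-monoˡ (<⇒≤ 0<W) (pow-mono r≤s)

  weight : Fin n → Fin n → ℚ
  weight t h = if adj G t h then pow (rank t h) else 0ℚ

  q : Point n
  q = comb weight

  q-total : total q ≡ 0ℚ
  q-total = total-comb weight

  module Sign {T : ArcSet n} (isT : IsOrientedSpanningTree G T) where

    open Tree T (proj₁ (proj₂ isT)) (proj₂ (proj₂ isT)) public

    module _ (k : Fin N) where

      a = tl k
      b = hd k
      open At k

      -- `InCut` speaks of the existence of walks. Comparing `side` turns the cut into a finite
      -- list, from which an arc of maximal rank can be chosen.
      crossing : List (Fin n × Fin n)
      crossing = filter (λ (t , h) → ¬? (side t Bool.≟ side h)) (arcs (adj G))

      ∈-crossing⁺ : ∀ {t h} → adj G t h ≡ true → side t ≢ side h → (t , h) ∈ crossing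
      ∈-crossing⁺ th∈G ≢side = ∈-filter⁺ (λ (t , h) → ¬? (side t Bool.≟ side h)) (∈-arcs⁺ (adj G) th∈G) ≢side

      ∈-crossing⁻ : ∀ {t h} → (t , h) ∈ crossing → adj G t h ≡ true × side t ≢ side h
      ∈-crossing⁻ th∈ with ∈-filter⁻ (λ (t , h) → ¬? (side t Bool.≟ side h)) {xs = arcs (adj G)} th∈
      ... | th∈G , ≢side = ∈-arcs⁻ (adj G) th∈G , ≢side

      inCut⇒crossing : ∀ {t h} → InCut G T a b t h → (t , h) ∈ crossing
      inCut⇒crossing (th∈G , inj₁ (t∈a , h∈b)) = ∈-crossing⁺ th∈G λ eq →
        case trans (sym (tail-shore t∈a)) (trans eq (head-shore h∈b)) of λ ()
      inCut⇒crossing (th∈G , inj₂ (t∈b , h∈a)) = ∈-crossing⁺ th∈G λ eq →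
        case trans (sym (head-shore t∈b)) (trans eq (tail-shore h∈a)) of λ ()

      crossing⇒inCut : ∀ {t h} → (t , h) ∈ crossing → InCut G T a b t h
      crossing⇒inCut {t} {h} th∈ with ∈-crossing⁻ th∈
      ... | th∈G , ≢side with side t in eqt | side h in eqh
      ... | true  | true  = contradiction refl ≢side
      ... | true  | false = th∈G , inj₂ (side-true eqt , side-false eqh)
      ... | false | true  = th∈G , inj₁ (side-false eqt , side-true eqh)
      ... | false | false = contradiction refl ≢side

      tree-arc-crosses : (a , b) ∈ crossing
      tree-arc-crosses = ∈-crossing⁺ (proj₁ isT a b (inT k)) λ eq →
        case trans (sym (tail-shore reach-refl)) (trans eq (head-shore reach-refl)) of λ ()

      module Dominant {t* h*} (star∈ : (t* , h*) ∈ crossing)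
        (dominant : ∀ {t h} → (t , h) ∈ crossing → rank t h ℕ.≤ rank t* h*) where

        term : Fin n → Fin n → ℚ
        term t h = weight t h * (dual k h - dual k t)

        top : ℚ
        top = pow (rank t* h*)

        rest : Fin n → Fin n → ℚ
        rest t h with t ≟ t* ×-dec h ≟ h*
        ... | yes _ = 0ℚ
        ... | no  _ = term t h

        zero-bound : ∀ {x} → x ≡ 0ℚ → W * ∣ x ∣ ≤ top
        zero-bound refl = subst (_≤ top) (sym (ℚ.*-zeroʳ W)) (<⇒≤ (pow-pos (rank t* h*)))

        -- By injectivity of the rank, any other crossing arc ranks strictly lower, which gains a
        -- factor `W`. Terms of arcs inside a shore vanish.
        rest-bound : ∀ t h → W * ∣ rest t h ∣ ≤ top
        rest-bound t h with t ≟ t* ×-dec h ≟ h*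
        ... | yes _ = zero-bound refl
        ... | no ≢star = bound
          where
          unit-bound : ∀ {σ} → ∣ σ ∣ ≡ 1ℚ → (t , h) ∈ crossing → W * ∣ pow (rank t h) * σ ∣ ≤ top
          unit-bound {σ} ∣σ∣≡1 th∈ = ≤-trans (≤-reflexive (cong (W *_)
              (trans (ℚ.∣p*q∣≡∣p∣*∣q∣ (pow (rank t h)) σ)
                (trans (cong₂ _*_ (ℚ.0≤p⇒∣p∣≡p (<⇒≤ (pow-pos (rank t h)))) ∣σ∣≡1) (ℚ.*-identityʳ (pow (rank t h)))))))
            -- The strict inequality unfolds to `suc (rank t h) ≤ rank t* h*`, and `W * pow r` is
            -- `pow (suc r)`.
            (pow-mono (ℕ.≤∧≢⇒< (dominant th∈) λ rank≡ →
              ≢star (order t h t* h* (proj₁ (∈-crossing⁻ th∈)) (proj₁ (∈-crossing⁻ star∈)) rank≡)))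
          bound : W * ∣ term t h ∣ ≤ top
          bound with adj G t h in th∈G
          ... | false = zero-bound (ℚ.*-zeroˡ (dual k h - dual k t))
          ... | true with side t in eqt | side h in eqh
          ... | true  | false = unit-bound refl (∈-crossing⁺ th∈G λ eq → case trans (sym eqt) (trans eq eqh) of λ ())
          ... | false | true  = unit-bound refl (∈-crossing⁺ th∈G λ eq → case trans (sym eqt) (trans eq eqh) of λ ())
          ... | true  | true  = zero-bound (ℚ.*-zeroʳ (pow (rank t h)))
          ... | false | false = zero-bound (ℚ.*-zeroʳ (pow (rank t h)))

        -- There are n² terms, each at most top / W, and n² < W.
        rest-sum : ∣ sum₂ rest ∣ < top
        rest-sum = ℚ.*-cancelˡ-<-nonNeg W {{nonNegative (<⇒≤ 0<W)}} (≤-<-trans total-bound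
            (ℚ.*-monoˡ-<-pos top {{positive (pow-pos (rank t* h*))}} n²<W))
          where
          total-bound : W * ∣ sum₂ rest ∣ ≤ count n * count n * top
          total-bound = ≤-trans (*-monoˡ (<⇒≤ 0<W) (≤-trans (∣sum∣≤ (λ t → sumQ (rest t))) (sum-mono (λ t → ∣sum∣≤ (rest t)))))
            (≤-trans (≤-reflexive (sym (sum₂-* W (λ t h → ∣ rest t h ∣))))
              (≤-trans (sum₂-mono {f = λ t h → W * ∣ rest t h ∣} {λ _ _ → top} rest-bound)
                (≤-reflexive (trans (sum-cong {n} (λ _ → sum-const n top))
                  (trans (sum-const n (count n * top)) (sym (ℚ.*-assoc (count n) (count n) top)))))))

        decomposition : coord k q ≡ term t* h* + sum₂ rest
        decomposition = trans (pair-comb (dual k) weight)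
          (trans (sum₂-cong split) (trans (sum₂-+ peak rest) (cong (_+ sum₂ rest) (trans (sum₂-single t* h* off) at-star))))
          where
          peak : Fin n → Fin n → ℚ
          peak t h with t ≟ t* ×-dec h ≟ h*
          ... | yes _ = term t h
          ... | no  _ = 0ℚ
          split : ∀ t h → term t h ≡ peak t h + rest t h
          split t h with t ≟ t* ×-dec h ≟ h*
          ... | yes _ = sym (ℚ.+-identityʳ (term t h))
          ... | no  _ = sym (ℚ.+-identityˡ (term t h))
          off : ∀ t h → ¬ (t ≡ t* × h ≡ h*) → peak t h ≡ 0ℚ
          off t h ≢star with t ≟ t* ×-dec h ≟ h*
          ... | yes eq = contradiction eq ≢star
          ... | no  _  = refl
          at-star : peak t* h* ≡ term t* h*
          at-star with t* ≟ t* ×-dec h* ≟ h*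
          ... | yes _ = refl
          ... | no ≢  = contradiction (refl , refl) ≢

        weight-star : weight t* h* ≡ top
        weight-star = cong (if_then top else 0ℚ) (proj₁ (∈-crossing⁻ star∈))

        parallel : side h* ≡ true → 0ℚ < coord k q
        parallel h*-head = subst (0ℚ <_) (sym (trans decomposition (cong (_+ sum₂ rest) (trans value (ℚ.*-identityʳ top)))))
            (<-≤-trans (<⇒0<- rest-sum) (ℚ.+-monoʳ-≤ top (-∣p∣≤p (sum₂ rest))))
          where
          t*-tail : side t* ≡ false
          t*-tail = Bool.¬-not λ t*-head → proj₂ (∈-crossing⁻ star∈) (trans t*-head (sym h*-head))
          value : term t* h* ≡ top * 1ℚ
          value = cong₂ _*_ weight-star (cong₂ (λ u v → indicator u - indicator v) h*-head t*-tail)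

        opposite : side h* ≡ false → coord k q < 0ℚ
        opposite h*-tail = subst (_< 0ℚ) (sym (trans decomposition (cong (_+ sum₂ rest) (trans value (negate top)))))
            (≤-<-trans (ℚ.+-monoʳ-≤ (- top) (p≤∣p∣ (sum₂ rest))) (pos-neg (subst (0ℚ <_) (flip top ∣ sum₂ rest ∣) (<⇒0<- rest-sum))))
          where
          t*-head : side t* ≡ true
          t*-head = Bool.¬-not λ t*-tail → proj₂ (∈-crossing⁻ star∈) (trans t*-tail (sym h*-tail))
          value : term t* h* ≡ top * - 1ℚ
          value = cong₂ _*_ weight-star (cong₂ (λ u v → indicator u - indicator v) h*-tail t*-head)
          negate : ∀ u → u * - 1ℚ ≡ - u
          negate = solve-∀ ℚ-ring
          flip : ∀ u v → u - v ≡ - (- u + v)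
          flip = solve-∀ ℚ-ring

      -- The shore of the head of the maximal crossing arc decides both the sign and semi-passivity.
      -- The value 0 never occurs, which is the genericity of `q`.
      sign : (coord k q < 0ℚ × InternallySemiPassive G rank T a b)
           ⊎ (0ℚ < coord k q × ¬ InternallySemiPassive G rank T a b)
      sign with maximum-in (λ (t , h) → rank t h) tree-arc-crosses
      ... | (t* , h*) , star∈ , dominant with side h* in eq
      ... | false = inj₁ (Dominant.opposite star∈ dominant eq
            , t* , h* , crossing⇒inCut star∈ , (λ t h th∈ → dominant (inCut⇒crossing th∈)) , side-false eq)
      ... | true  = inj₂ (Dominant.parallel star∈ dominant eq , not-passive)
        where
        not-passive : ¬ InternallySemiPassive G rank T a b
        -- A witness of semi-passivity is also of maximal rank in the cut, hence is this very arc,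
        -- whose head lies in the other shore.
        not-passive (t , h , th∈ , max , h∈a) with order t h t* h* (proj₁ th∈) (proj₁ (∈-crossing⁻ star∈))
            (ℕ.≤-antisym (dominant (inCut⇒crossing th∈)) (max t* h* (crossing⇒inCut star∈)))
        ... | refl , refl = case trans (sym eq) (tail-shore h∈a) of λ ()

-- Integrality

IsInt : ℚ → Set
IsInt x = ∃[ z ] x ≡ toQ z

int-+ : ∀ {x y} → IsInt x → IsInt y → IsInt (x + y)
int-+ (u , refl) (v , refl) = u ℤ.+ v , sym (toQ-+ u v)

int-* : ∀ {x y} → IsInt x → IsInt y → IsInt (x * y)
int-* (u , refl) (v , refl) = u ℤ.* v , sym (toQ-* u v)

int-neg : ∀ {x} → IsInt x → IsInt (- x)
int-neg (u , refl) = ℤ.- u , sym (toQ-neg u)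

int-sum : ∀ {k} (f : Fin k → ℚ) → (∀ i → IsInt (f i)) → IsInt (sumQ f)
int-sum {zero}  f F = ℤ.+ 0 , refl
int-sum {suc k} f F = int-+ (F zero) (int-sum (f ∘ suc) (F ∘ suc))

int-ind : ∀ {n} (u c : Fin n) → IsInt (ind u c)
int-ind u c with u ≟ c
... | yes _ = ℤ.+ 1 , refl
... | no  _ = ℤ.+ 0 , refl

int-arcVec : ∀ {n} (t h c : Fin n) → IsInt (arcVec t h c)
int-arcVec t h c = subst IsInt (sym (arcVec≡ind-ind t h c)) (int-+ (int-ind h c) (int-neg (int-ind t c)))

int-indicator : ∀ s → IsInt (indicator s)
int-indicator true  = ℤ.+ 1 , refl
int-indicator false = ℤ.+ 0 , refl

toQ-ℕ : ℕ → ℚ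
toQ-ℕ k = toQ (ℤ.+ k)

toQ-ℕ-nonneg : ∀ k → 0ℚ ≤ toQ-ℕ k
toQ-ℕ-nonneg k = toQ-mono {ℤ.+ 0} {ℤ.+ k} (ℤ.+≤+ z≤n)

toQ-ℕ-injective : ∀ {k l} → toQ-ℕ k ≡ toQ-ℕ l → k ≡ l
toQ-ℕ-injective eq = ℤ.+-injective (toQ-injective eq)

toQ-ℕ-mono : ∀ {k l} → k ℕ.≤ l → toQ-ℕ k ≤ toQ-ℕ l
toQ-ℕ-mono k≤l = toQ-mono (ℤ.+≤+ k≤l)

toQ-ℕ-cancel-≤ : ∀ {k l} → toQ-ℕ k ≤ toQ-ℕ l → k ℕ.≤ l
toQ-ℕ-cancel-≤ k≤l = ℤ.drop‿+≤+ (toQ-cancel-≤ k≤l)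

int-nonneg⇒ℕ : ∀ {x} → IsInt x → 0ℚ ≤ x → ∃[ k ] x ≡ toQ-ℕ k
int-nonneg⇒ℕ (ℤ.+ k , x≡) 0≤x = k , x≡
int-nonneg⇒ℕ (-[1+ k ] , refl) 0≤x = case toQ-cancel-≤ {ℤ.+ 0} { -[1+ k ]} 0≤x of λ ()

int-negative : ∀ {x} → IsInt x → x < 0ℚ → x ≤ - 1ℚ
int-negative (ℤ.+ k , refl) x<0 = contradiction (<-≤-trans x<0 (toQ-ℕ-nonneg k)) (ℚ.<-irrefl refl)
int-negative (-[1+ k ] , refl) _ = toQ-mono { -[1+ k ]} { -[1+ 0 ]} (ℤ.-≤- z≤n)

-- For an integer c and |e| < M, the number M c + e has the sign of c, or the sign of e if c = 0.
-- This is how a half-open condition on c becomes a condition on the perturbed coordinate.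
module _ {c e M : ℚ} (c-int : IsInt c) (∣e∣<M : ∣ e ∣ < M) where

  private
    0<M : 0ℚ < M
    0<M = ≤-<-trans (ℚ.0≤∣p∣ e) ∣e∣<M

  perturbed-nonneg : 0ℚ ≤ M * c + e → 0ℚ ≤ c
  perturbed-nonneg 0≤y = ≮⇒≥ λ c<0 → ℚ.<-irrefl refl (≤-<-trans 0≤y
    (≤-<-trans (ℚ.+-mono-≤ (*-monoˡ (<⇒≤ 0<M) (int-negative c-int c<0)) (p≤∣p∣ e))
      (pos-neg (subst (0ℚ <_) (regroup M ∣ e ∣) (<⇒0<- ∣e∣<M)))))
    where
    regroup : ∀ m v → m - v ≡ - (m * - 1ℚ + v)
    regroup = solve-∀ ℚ-ring

  perturbed-≢0 : e < 0ℚ → 0ℚ ≤ M * c + e → c ≢ 0ℚ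
  perturbed-≢0 e<0 0≤y refl = ℚ.<-irrefl refl (≤-<-trans 0≤y (subst (_< 0ℚ) (drop M e) e<0))
    where
    drop : ∀ m e → e ≡ m * 0ℚ + e
    drop = solve-∀ ℚ-ring

  perturbed-pos : 0ℚ ≤ c → 0ℚ < e → 0ℚ < M * c + e
  perturbed-pos 0≤c 0<e = ℚ.+-mono-≤-< (*-nonneg (<⇒≤ 0<M) 0≤c) 0<e

  perturbed-pos′ : 1ℚ ≤ c → 0ℚ < M * c + e
  perturbed-pos′ 1≤c = <-≤-trans (<⇒0<- ∣e∣<M)
    (ℚ.+-mono-≤ (subst (_≤ M * c) (ℚ.*-identityʳ M) (*-monoˡ (<⇒≤ 0<M) 1≤c)) (-∣p∣≤p e))

-- Counting the lattice points of half-open simplices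

trues : ∀ {k} → Vec Bool k → ℕ
trues []          = 0
trues (true ∷ p)  = suc (trues p)
trues (false ∷ p) = trues p

trues≤ : ∀ {k} (p : Vec Bool k) → trues p ℕ.≤ k
trues≤ []          = z≤n
trues≤ (true ∷ p)  = s≤s (trues≤ p)
trues≤ (false ∷ p) = ℕ.m≤n⇒m≤1+n (trues≤ p)

truePositions : ∀ {k} → Vec Bool k → List (Fin k)
truePositions []          = []
truePositions (true ∷ p)  = zero ∷ map suc (truePositions p)
truePositions (false ∷ p) = map suc (truePositions p)

length-truePositions : ∀ {k} (p : Vec Bool k) → length (truePositions p) ≡ trues p
length-truePositions []          = refl
length-truePositions (true ∷ p)  = cong suc (trans (List.length-map suc (truePositions p)) (length-truePositions p))
length-truePositions (false ∷ p) = trans (List.length-map suc (truePositions p)) (length-truePositions p)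

∈-truePositions⁺ : ∀ {k} (p : Vec Bool k) i → Vec.lookup p i ≡ true → i ∈ truePositions p
∈-truePositions⁺ (true ∷ p)  zero    _  = here refl
∈-truePositions⁺ (true ∷ p)  (suc i) eq = there (∈-map⁺ suc (∈-truePositions⁺ p i eq))
∈-truePositions⁺ (false ∷ p) (suc i) eq = ∈-map⁺ suc (∈-truePositions⁺ p i eq)

∈-truePositions⁻ : ∀ {k} (p : Vec Bool k) {i} → i ∈ truePositions p → Vec.lookup p i ≡ true
∈-truePositions⁻ (true ∷ p)  (here refl) = refl
∈-truePositions⁻ (true ∷ p)  (there i∈) with ∈-map⁻ suc i∈
... | _ , i∈p , refl = ∈-truePositions⁻ p i∈p
∈-truePositions⁻ (false ∷ p) i∈ with ∈-map⁻ suc i∈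
... | _ , i∈p , refl = ∈-truePositions⁻ p i∈p

truePositions-unique : ∀ {k} (p : Vec Bool k) → Unique (truePositions p)
truePositions-unique []          = []
truePositions-unique (true ∷ p)  =
  All.tabulate (λ i∈ → λ { refl → case proj₂ (proj₂ (∈-map⁻ suc i∈)) of λ () })
  ∷ Unique.map⁺ Fin.suc-injective (truePositions-unique p)
truePositions-unique (false ∷ p) = Unique.map⁺ Fin.suc-injective (truePositions-unique p)

bump : ∀ {k} → Vec ℕ (suc k) → Vec ℕ (suc k)
bump (c ∷ v) = suc c ∷ v

bump-injective : ∀ {k} {v w : Vec ℕ (suc k)} → bump v ≡ bump w → v ≡ w
bump-injective {v = _ ∷ _} {_ ∷ _} refl = refl

-- Enumerates the natural vectors of sum at most t that are positive where p is `true`. Either the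
-- first entry is 0, or one unit is taken off it; that unit already meets the positivity demand, so
-- the recursion continues with `false`.
bounded : ∀ {k} → Vec Bool k → ℕ → List (Vec ℕ k)
bounded []          t       = [] ∷ []
bounded (false ∷ p) zero    = map (0 ∷_) (bounded p zero)
bounded (false ∷ p) (suc t) = map (0 ∷_) (bounded p (suc t)) ++ map bump (bounded (false ∷ p) t)
bounded (true ∷ p)  zero    = []
bounded (true ∷ p)  (suc t) = map bump (bounded (false ∷ p) t)

Positive-on : ∀ {k} → Vec Bool k → Vec ℕ k → Set
Positive-on p v = ∀ i → Vec.lookup p i ≡ true → 1 ℕ.≤ Vec.lookup v i

∈-bounded⁺ : ∀ {k} (p : Vec Bool k) {t v} → Positive-on p v → Vec.sum v ℕ.≤ t → v ∈ bounded p t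
∈-bounded⁺ []          {v = []} _ _ = here refl
∈-bounded⁺ (false ∷ p) {zero}  {zero ∷ v}  P≥1 Σ≤t = ∈-map⁺ (0 ∷_) (∈-bounded⁺ p (P≥1 ∘ suc) Σ≤t)
∈-bounded⁺ (false ∷ p) {suc t} {zero ∷ v}  P≥1 Σ≤t = ∈-++⁺ˡ (∈-map⁺ (0 ∷_) (∈-bounded⁺ p (P≥1 ∘ suc) Σ≤t))
∈-bounded⁺ (false ∷ p) {suc t} {suc c ∷ v} P≥1 (s≤s Σ≤t) = ∈-++⁺ʳ (map (0 ∷_) (bounded p (suc t)))
  (∈-map⁺ bump (∈-bounded⁺ (false ∷ p) {v = c ∷ v} (λ { (suc i) → P≥1 (suc i) }) Σ≤t))
∈-bounded⁺ (true ∷ p)  {t}     {zero ∷ v}  P≥1 Σ≤t = case P≥1 zero refl of λ ()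
∈-bounded⁺ (true ∷ p)  {suc t} {suc c ∷ v} P≥1 (s≤s Σ≤t) =
  ∈-map⁺ bump (∈-bounded⁺ (false ∷ p) {v = c ∷ v} (λ { (suc i) → P≥1 (suc i) }) Σ≤t)

∈-bounded⁻ : ∀ {k} (p : Vec Bool k) t {v} → v ∈ bounded p t → Positive-on p v × Vec.sum v ℕ.≤ t
∈-bounded⁻ []          t       (here refl) = (λ ()) , z≤n
∈-bounded⁻ (false ∷ p) zero    v∈ with ∈-map⁻ (0 ∷_) v∈
... | _ , w∈ , refl with ∈-bounded⁻ p zero w∈
... | P≥1 , Σ≤t = (λ { (suc i) → P≥1 i }) , Σ≤t
∈-bounded⁻ (false ∷ p) (suc t) v∈ with ∈-++⁻ (map (0 ∷_) (bounded p (suc t))) v∈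
... | inj₁ v∈₀ with ∈-map⁻ (0 ∷_) v∈₀
... | _ , w∈ , refl with ∈-bounded⁻ p (suc t) w∈
... | P≥1 , Σ≤t = (λ { (suc i) → P≥1 i }) , Σ≤t
∈-bounded⁻ (false ∷ p) (suc t) v∈ | inj₂ v∈₁ with ∈-map⁻ bump v∈₁
... | c ∷ w , w∈ , refl with ∈-bounded⁻ (false ∷ p) t w∈
... | P≥1 , Σ≤t = (λ { (suc i) → P≥1 (suc i) }) , s≤s Σ≤t
∈-bounded⁻ (true ∷ p)  (suc t) v∈ with ∈-map⁻ bump v∈
... | c ∷ w , w∈ , refl with ∈-bounded⁻ (false ∷ p) t w∈
... | P≥1 , Σ≤t = (λ { zero _ → s≤s z≤n ; (suc i) → P≥1 (suc i) }) , s≤s Σ≤t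

bounded-unique : ∀ {k} (p : Vec Bool k) t → Unique (bounded p t)
bounded-unique []          t       = [] ∷ []
bounded-unique (false ∷ p) zero    = Unique.map⁺ Vec.∷-injectiveʳ (bounded-unique p zero)
bounded-unique (false ∷ p) (suc t) = Unique.++⁺
  (Unique.map⁺ Vec.∷-injectiveʳ (bounded-unique p (suc t)))
  (Unique.map⁺ bump-injective (bounded-unique (false ∷ p) t))
  (λ (v∈₀ , v∈₁) → heads-differ (∈-map⁻ (0 ∷_) v∈₀) (∈-map⁻ bump v∈₁))
  where
  heads-differ : ∀ {v xs ys} → ∃[ w ] (w ∈ xs × v ≡ 0 ∷ w) → ∃[ w ] (w ∈ ys × v ≡ bump w) → ⊥
  heads-differ (_ , _ , refl) (_ ∷ _ , _ , ())
bounded-unique (true ∷ p)  zero    = []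
bounded-unique (true ∷ p)  (suc t) = Unique.map⁺ bump-injective (bounded-unique (false ∷ p) t)

-- Pascal's rule, the two summands being a first entry that is zero or positive. A `true` entry
-- costs one unit of t, which cancels against the increase of `trues`.
length-bounded : ∀ {k} (p : Vec Bool k) t → length (bounded p t) ≡ (t ℕ.+ k ℕ.∸ trues p) C k
length-bounded []          t    = refl
length-bounded {suc k} (false ∷ p) zero = trans (List.length-map (0 ∷_) (bounded p zero)) (trans (length-bounded p zero) corner)
  where
  -- At t = 0 only the zero vector can occur: both binomials are 1 if no entry must be positive, and
  -- otherwise both vanish because the upper index falls below the lower one.
  corner : (k ℕ.∸ trues p) C k ≡ (suc k ℕ.∸ trues p) C suc k
  corner with trues p | trues≤ p
  ... | zero  | _ = trans (nCn≡1 k) (sym (nCn≡1 (suc k)))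
  ... | suc r | s≤s r≤k = trans (k>n⇒nCk≡0 (s≤s (ℕ.m∸n≤m _ r))) (sym (k>n⇒nCk≡0 (s≤s (ℕ.m∸n≤m k r))))
length-bounded {suc k} (false ∷ p) (suc t) = begin
  length (map (0 ∷_) (bounded p (suc t)) ++ map bump (bounded (false ∷ p) t))
    ≡⟨ List.length-++ (map (0 ∷_) (bounded p (suc t))) ⟩
  length (map (0 ∷_) (bounded p (suc t))) ℕ.+ length (map bump (bounded (false ∷ p) t))
    ≡⟨ cong₂ ℕ._+_ (trans (List.length-map (0 ∷_) (bounded p (suc t))) (length-bounded p (suc t)))
                   (trans (List.length-map bump (bounded (false ∷ p) t)) (length-bounded (false ∷ p) t)) ⟩
  (suc t ℕ.+ k ℕ.∸ trues p) C k ℕ.+ (t ℕ.+ suc k ℕ.∸ trues p) C suc k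
    ≡⟨ cong (λ x → (suc t ℕ.+ k ℕ.∸ trues p) C k ℕ.+ (x ℕ.∸ trues p) C suc k) (ℕ.+-suc t k) ⟩
  (suc t ℕ.+ k ℕ.∸ trues p) C k ℕ.+ (suc t ℕ.+ k ℕ.∸ trues p) C suc k
    ≡⟨ nCk+nC[k+1]≡[n+1]C[k+1] (suc t ℕ.+ k ℕ.∸ trues p) k ⟩
  suc (suc t ℕ.+ k ℕ.∸ trues p) C suc k
    ≡⟨ cong (_C suc k) (sym (ℕ.+-∸-assoc 1 (ℕ.≤-trans (trues≤ p) (ℕ.m≤n+m k (suc t))))) ⟩
  (suc (suc t ℕ.+ k) ℕ.∸ trues p) C suc k
    ≡⟨ cong (λ x → (x ℕ.∸ trues p) C suc k) (sym (ℕ.+-suc (suc t) k)) ⟩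
  (suc t ℕ.+ suc k ℕ.∸ trues p) C suc k ∎
  where open ≡-Reasoning
length-bounded {suc k} (true ∷ p) zero = sym (k>n⇒nCk≡0 (s≤s (ℕ.m∸n≤m k (trues p))))
length-bounded {suc k} (true ∷ p) (suc t) =
  trans (List.length-map bump (bounded (false ∷ p) t)) (length-bounded (false ∷ p) t)

-- Dimension

LinearRelation : ∀ {k m} → (Fin k → Point m) → Set
LinearRelation {k} v = Σ (Fin k → ℚ) λ γ → (∃[ j ] γ j ≢ 0ℚ) × (∀ c → sumQ (λ j → γ j * v j c) ≡ 0ℚ)

-- Gaussian elimination. A zero first vector is itself a relation; otherwise it has a pivot in
-- column `c`, which is cleared from the other vectors and deleted by `punchIn`. A relation among
-- these extends by the coefficient of the first vector.
linearly-dependent : ∀ {k m} → m ℕ.< k → (v : Fin k → Point m) → LinearRelation v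
linearly-dependent {suc k} {m} m<k v with Fin.any? (λ c → ¬? (v zero c ℚ.≟ 0ℚ))
... | no v₀≡0 = ind zero , (zero , λ ()) , λ c →
  trans (sum-single zero (λ j j≢0 → trans (cong (_* v j c) (ind-≢ (j≢0 ∘ sym))) (ℚ.*-zeroˡ (v j c))))
    (trans (ℚ.*-identityˡ (v zero c)) (decidable-stable (v zero c ℚ.≟ 0ℚ) (λ v₀c≢0 → v₀≡0 (c , v₀c≢0))))
linearly-dependent {suc k} {suc m} (s≤s m<k) v | yes (c , v₀c≢0) =
  extend-relation (inverse (v zero c) v₀c≢0)
  where
  extend-relation : ∃[ r ] r * v zero c ≡ 1ℚ → LinearRelation v
  extend-relation (r , rv₀c≡1) = γ , (suc (proj₁ nonzero) , proj₂ nonzero) , relation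
    where
    reduced : Fin k → Point (suc m)
    reduced j x = v (suc j) x - (v (suc j) c * r) * v zero x
    smaller = linearly-dependent m<k (λ j x → reduced j (Fin.punchIn c x))
    γ′ = proj₁ smaller
    nonzero = proj₁ (proj₂ smaller)
    γ : Fin (suc k) → ℚ
    γ zero    = - sumQ (λ j → γ′ j * (v (suc j) c * r))
    γ (suc j) = γ′ j
    combined : ∀ x → sumQ (λ j → γ j * v j x) ≡ sumQ (λ j → γ′ j * reduced j x)
    combined x = sym (begin
      sumQ (λ j → γ′ j * (v (suc j) x - (v (suc j) c * r) * v zero x))
        ≡⟨ sum-cong (λ j → distrib (γ′ j) (v (suc j) x) (v (suc j) c * r) (v zero x)) ⟩
      sumQ (λ j → γ′ j * v (suc j) x - γ′ j * (v (suc j) c * r) * v zero x)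
        ≡⟨ sum-- (λ j → γ′ j * v (suc j) x) (λ j → γ′ j * (v (suc j) c * r) * v zero x) ⟩
      sumQ (λ j → γ′ j * v (suc j) x) - sumQ (λ j → γ′ j * (v (suc j) c * r) * v zero x)
        ≡⟨ cong (λ w → sumQ (λ j → γ′ j * v (suc j) x) - w) (sum-*ʳ (v zero x) (λ j → γ′ j * (v (suc j) c * r))) ⟩
      sumQ (λ j → γ′ j * v (suc j) x) - sumQ (λ j → γ′ j * (v (suc j) c * r)) * v zero x
        ≡⟨ reorder (sumQ (λ j → γ′ j * v (suc j) x)) (sumQ (λ j → γ′ j * (v (suc j) c * r))) (v zero x) ⟩
      sumQ (λ j → γ j * v j x) ∎)
      where
      open ≡-Reasoning
      distrib : ∀ g p s w → g * (p - s * w) ≡ g * p - g * s * w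
      distrib = solve-∀ ℚ-ring
      reorder : ∀ p s w → p - s * w ≡ - s * w + p
      reorder = solve-∀ ℚ-ring
    pivot-column : ∀ j → reduced j c ≡ 0ℚ
    pivot-column j = trans (assoc (v (suc j) c) r (v zero c)) (trans (cong (λ w → v (suc j) c - v (suc j) c * w) rv₀c≡1) (cancel (v (suc j) c)))
      where
      assoc : ∀ p r w → p - p * r * w ≡ p - p * (r * w)
      assoc = solve-∀ ℚ-ring
      cancel : ∀ p → p - p * 1ℚ ≡ 0ℚ
      cancel = solve-∀ ℚ-ring
    relation : ∀ x → sumQ (λ j → γ j * v j x) ≡ 0ℚ
    relation x with c ≟ x
    ... | yes refl = trans (combined c) (sum-zero (λ j → trans (cong (γ′ j *_) (pivot-column j)) (ℚ.*-zeroʳ (γ′ j))))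
    ... | no c≢x = trans (combined x) (subst (λ x → sumQ (λ j → γ′ j * reduced j x) ≡ 0ℚ) (Fin.punchIn-punchOut c≢x)
                     (proj₂ (proj₂ smaller) (Fin.punchOut c≢x)))

module _ {n} (G : SimpleGraph n) {a b} (ab∈G : adj G a b ≡ true) {T : ArcSet n} (isT : IsOrientedSpanningTree G T) where

  open Polytope G
  open Tree T (proj₁ (proj₂ isT)) (proj₂ (proj₂ isT))

  -- Otherwise the origin and d + 1 arcs of the tree would be d + 2 affinely independent points, as
  -- the dual basis isolates each coefficient.
  N≤dim : ∀ {d} → IsDim (SymEdge G) d → N ℕ.≤ d
  N≤dim {d} (_ , maximal) = ℕ.≮⇒≥ λ d<N → maximal (points d<N) (points∈P d<N) (independent d<N)
    where
    points : d ℕ.< N → Fin (suc (suc d)) → Point n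
    points d<N zero    c = 0ℚ
    points d<N (suc i) c = basis (Fin.inject≤ i d<N) c
    points∈P : ∀ d<N j → SymEdge G (points d<N j)
    points∈P d<N zero    = rep-mono ab∈G (A-sym ab∈G) rep-zero 0≤1
    points∈P d<N (suc i) = rep-arc (proj₁ isT _ _ (inT (Fin.inject≤ i d<N)))
    independent : ∀ d<N → AffIndep (points d<N)
    independent d<N γ Σγ≡0 relation = λ { zero → first ; (suc i) → later i }
      where
      later : ∀ i → γ (suc i) ≡ 0ℚ
      later i = begin
        γ (suc i)
          ≡⟨ ℚ.*-identityʳ (γ (suc i)) ⟨
        γ (suc i) * 1ℚ
          ≡⟨ cong (γ (suc i) *_) (ind-refl (ι i)) ⟨
        γ (suc i) * ind (ι i) (ι i)
          ≡⟨ sum-single i (λ j j≢i → trans (cong (γ (suc j) *_) (ind-≢ (j≢i ∘ Fin.inject≤-injective d<N d<N j i))) (ℚ.*-zeroʳ (γ (suc j)))) ⟨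
        sumQ (λ j → γ (suc j) * ind (ι j) (ι i))
          ≡⟨ sum-cong (λ j → trans (pair-* (dual (ι i)) (γ (suc j)) (basis (ι j))) (cong (γ (suc j) *_) (coord-basis (ι i) (ι j)))) ⟨
        sumQ (λ j → coord (ι i) (λ c → γ (suc j) * basis (ι j) c))
          ≡⟨ pair-sum (dual (ι i)) (λ j c → γ (suc j) * basis (ι j) c) ⟨
        coord (ι i) (λ c → sumQ (λ j → γ (suc j) * basis (ι j) c))
          ≡⟨ sum-zero (λ c → trans (cong (dual (ι i) c *_) (trans (drop (γ zero) _) (relation c))) (ℚ.*-zeroʳ (dual (ι i) c))) ⟩
        0ℚ ∎
        where
        open ≡-Reasoning
        ι : Fin (suc d) → Fin N
        ι i = Fin.inject≤ i d<N
        drop : ∀ g s → s ≡ g * 0ℚ + s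
        drop = solve-∀ ℚ-ring
      first : γ zero ≡ 0ℚ
      first = trans (sym (trans (cong (γ zero +_) (sum-zero later)) (ℚ.+-identityʳ (γ zero)))) Σγ≡0

  -- A point is recorded by its N tree coordinates together with a constant 1, which encodes the
  -- affine condition. If N < d, the d + 1 records in dimension N + 1 would satisfy a relation, and
  -- `expansion` carries it back to the points.
  dim≤N : ∀ {d} → IsDim (SymEdge G) d → d ℕ.≤ N
  dim≤N {d} ((q , q∈P , independent) , _) = ℕ.≮⇒≥ λ N<d →
    refute (linearly-dependent (s≤s N<d) (λ j → extend 1ℚ (λ k → coord k (q j))))
    where
    refute : ¬ LinearRelation (λ j → extend 1ℚ (λ k → coord k (q j)))
    refute (γ , (j , γj≢0) , relation) = γj≢0 (independent γ Σγ≡0 vanishes j)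
      where
      Σγ≡0 : sumQ γ ≡ 0ℚ
      Σγ≡0 = trans (sum-cong (λ j → sym (ℚ.*-identityʳ (γ j)))) (relation zero)
      vanishes : ∀ c → sumQ (λ j → γ j * q j c) ≡ 0ℚ
      vanishes c = begin
        sumQ (λ j → γ j * q j c)
          ≡⟨ sum-cong (λ j → cong (γ j *_) (expansion (rep-total (q∈P j)) c)) ⟩
        sumQ (λ j → γ j * sumQ (λ k → coord k (q j) * basis k c))
          ≡⟨ sum-cong (λ j → sym (sum-* (γ j) (λ k → coord k (q j) * basis k c))) ⟩
        sumQ (λ j → sumQ (λ k → γ j * (coord k (q j) * basis k c)))
          ≡⟨ sum-swap (λ j k → γ j * (coord k (q j) * basis k c)) ⟩
        sumQ (λ k → sumQ (λ j → γ j * (coord k (q j) * basis k c)))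
          ≡⟨ sum-cong (λ k → trans (sum-cong (λ j → sym (ℚ.*-assoc (γ j) (coord k (q j)) (basis k c))))
                                   (sum-*ʳ (basis k c) (λ j → γ j * coord k (q j)))) ⟩
        sumQ (λ k → sumQ (λ j → γ j * coord k (q j)) * basis k c)
          ≡⟨ sum-zero (λ k → trans (cong (_* basis k c) (relation (suc k))) (ℚ.*-zeroˡ (basis k c))) ⟩
        0ℚ ∎
        where open ≡-Reasoning

  N≡dim : ∀ {d} → IsDim (SymEdge G) d → N ≡ d
  N≡dim dim = ℕ.≤-antisym (N≤dim dim) (dim≤N dim)

-- Assembling the count

length-set-equal : ∀ {X : Set} {xs ys : List X} → Unique xs → Unique ys →
  (∀ {x} → x ∈ xs → x ∈ ys) → (∀ {x} → x ∈ ys → x ∈ xs) → length xs ≡ length ys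
length-set-equal uniq-xs uniq-ys ⊆ ⊇ = ↭-length (∼bag⇒↭ (unique∧set⇒bag uniq-xs uniq-ys (mk⇔ ⊆ ⊇)))

concatMap-unique : ∀ {X Y : Set} (f : X → List Y) {xs} → Unique xs → (∀ x → Unique (f x)) →
  (∀ {x x′ y} → x ∈ xs → x′ ∈ xs → y ∈ f x → y ∈ f x′ → x ≡ x′) → Unique (concatMap f xs)
concatMap-unique f {[]}     _             blocks disjoint = []
concatMap-unique f {x ∷ xs} (x∉xs ∷ uniq) blocks disjoint = Unique.++⁺ (blocks x)
  (concatMap-unique f uniq blocks (λ x∈ x′∈ → disjoint (there x∈) (there x′∈)))
  λ (y∈fx , y∈rest) → let (x′ , x′∈ , y∈fx′) = find (∈-concatMap⁻ f y∈rest) in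
    All.lookup x∉xs x′∈ (disjoint (here refl) (there x′∈) y∈fx y∈fx′)

length-concatMap : ∀ {X Y : Set} (f : X → List Y) xs → length (concatMap f xs) ≡ sum (map (length ∘ f) xs)
length-concatMap f []       = refl
length-concatMap f (x ∷ xs) = trans (List.length-++ (f x)) (cong (length (f x) ℕ.+_) (length-concatMap f xs))

sum-map-const : ∀ {X : Set} (f : X → ℕ) c xs → (∀ {x} → x ∈ xs → f x ≡ c) → sum (map f xs) ≡ length xs ℕ.* c
sum-map-const f c []       f≡c = refl
sum-map-const f c (x ∷ xs) f≡c = cong₂ ℕ._+_ (f≡c (here refl)) (sum-map-const f c xs (f≡c ∘ there))

sum-map-cong : ∀ {X : Set} {f g : X → ℕ} xs → (∀ x → f x ≡ g x) → sum (map f xs) ≡ sum (map g xs)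
sum-map-cong xs f≗g = cong sum (List.map-cong f≗g xs)

point : ∀ {n} → Vec ℤ n → Point n
point z c = toQ (Vec.lookup z c)

point-injective : ∀ {n} {z w : Vec ℤ n} → (∀ c → point z c ≡ point w c) → z ≡ w
point-injective {z = z} {w} z≗w = trans (sym (Vec.tabulate∘lookup z))
  (trans (Vec.tabulate-cong (λ c → toQ-injective (z≗w c))) (Vec.tabulate∘lookup w))

sum-toQ-ℕ : ∀ {k} (v : Vec ℕ k) → sumQ (λ i → toQ-ℕ (Vec.lookup v i)) ≡ toQ-ℕ (Vec.sum v)
sum-toQ-ℕ []      = refl
sum-toQ-ℕ (c ∷ v) = trans (cong (toQ-ℕ c +_) (sum-toQ-ℕ v)) (sym (toQ-+ (ℤ.+ c) (ℤ.+ Vec.sum v)))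

module Count {n m} (G : SimpleGraph n) (𝒯 : Fin m → ArcSet n) (dissecting : DissectingTreeSet G 𝒯)
  {a b} (ab∈G : adj G a b ≡ true) (rank : Fin n → Fin n → ℕ) (order : IsArcOrder G rank) where

  open Polytope G
  open Dissection G 𝒯 dissecting ab∈G
  open Direction G rank order using (weight; pow; pow-pos; q; q-total; module Sign)
  module Sg (j : Fin m) = Sign (isTree j)

  dilate⇒rep : ∀ t {x} → Dilate t (SymEdge G) x → Rep A x (toQ-ℕ t)
  dilate⇒rep t (p , p∈P , x≡) = rep-cong (λ c → sym (x≡ c)) (ℚ.*-identityʳ (toQ-ℕ t)) (rep-* (toQ-ℕ-nonneg t) p∈P)

  rep⇒dilate : ∀ t {x} → Rep A x (toQ-ℕ t) → Dilate t (SymEdge G) x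
  -- The dilate by 0 still asks for a point of the polytope.
  rep⇒dilate zero X = arcVec a b , rep-arc ab∈G , λ c → trans (rep-0⇒0 X c) (sym (ℚ.*-zeroˡ (arcVec a b c)))
  rep⇒dilate (suc t) {x} X = from (inverse-pos 0<t)
    where
    0<t : 0ℚ < toQ-ℕ (suc t)
    0<t = <-≤-trans 0<1 (toQ-ℕ-mono {1} {suc t} (s≤s z≤n))
    from : ∃[ u ] (0ℚ < u × u * toQ-ℕ (suc t) ≡ 1ℚ) → Dilate (suc t) (SymEdge G) x
    from (u , 0<u , ut≡1) = (λ c → u * x c) , rep-cong (λ _ → refl) ut≡1 (rep-* (<⇒≤ 0<u) X)
      , λ c → sym (unscale u (toQ-ℕ (suc t)) ut≡1 (x c))

  slope : ∀ j → Fin (Tr.N j) → ℚ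
  slope j k = Tr.coord j k q

  slope≢0 : ∀ j k → slope j k < 0ℚ ⊎ 0ℚ < slope j k
  slope≢0 j k = Sum.map proj₁ proj₁ (Sg.sign j k)

  -- Read off from the sign of the slope, which is decidable; `Sign.sign` translates to
  -- semi-passivity.
  passive : ∀ j → Vec Bool (Tr.N j)
  passive j = Vec.tabulate (λ k → does (slope j k <? 0ℚ))

  passive⁺ : ∀ j k → slope j k < 0ℚ → Vec.lookup (passive j) k ≡ true
  passive⁺ j k s<0 = trans (Vec.lookup∘tabulate _ k) (dec-true (slope j k <? 0ℚ) s<0)

  passive⁻ : ∀ j k → Vec.lookup (passive j) k ≡ true → slope j k < 0ℚ
  passive⁻ j k eq with slope j k <? 0ℚ in dec-eq
  ... | yes s<0 = s<0
  ... | no  _   = case trans (sym eq) (trans (Vec.lookup∘tabulate _ k) (cong does dec-eq)) of λ ()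

  -- The half-open cone of the tree j: the points x such that x + ε q lies in its interior for small ε > 0.
  HalfOpen : Fin m → Point n → Set
  HalfOpen j x = ∀ k → 0ℚ ≤ Tr.coord j k x × (slope j k < 0ℚ → Tr.coord j k x ≢ 0ℚ)

  -- Exceeds every |slope j k|, over all trees at once.
  M : ℚ
  M = norm q + 1ℚ

  0≤M : 0ℚ ≤ M
  0≤M = +-nonneg (norm-nonneg q) 0≤1

  ∣slope∣<M : ∀ j k → ∣ slope j k ∣ < M
  ∣slope∣<M j k = ≤-<-trans (Tr.∣coord∣≤norm j k q)
    (subst (_< M) (ℚ.+-identityʳ (norm q)) (ℚ.+-monoʳ-< (norm q) 0<1))

  perturb : Point n → Point n
  perturb x c = M * x c + q c

  perturb-coord : ∀ j k x → Tr.coord j k (perturb x) ≡ M * Tr.coord j k x + slope j k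
  perturb-coord j k x = trans (pair-+ (Tr.dual j k) (λ c → M * x c) q) (cong (_+ slope j k) (pair-* (Tr.dual j k) M x))

  perturb-total : ∀ {x} → total x ≡ 0ℚ → total (perturb x) ≡ 0ℚ
  perturb-total {x} Σx≡0 = trans (sum-+ (λ c → M * x c) q) (trans (cong₂ _+_ (total-* M {x} Σx≡0) q-total) (ℚ.+-identityˡ 0ℚ))

  q-rep : Rep A q (sumArcs weight (λ _ _ → 1ℚ))
  q-rep = weight , weight-nonneg , weight-support , refl , λ _ → refl
    where
    weight-nonneg : ∀ t h → 0ℚ ≤ weight t h
    weight-nonneg t h with adj G t h
    ... | true  = <⇒≤ (pow-pos (rank t h))
    ... | false = ≤-refl
    weight-support : Support A weight
    weight-support t h th∉G with adj G t h
    ... | false = refl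

  coord-int : ∀ j k z → IsInt (Tr.coord j k (point z))
  coord-int j k z = int-sum (λ c → Tr.dual j k c * point z c)
    (λ c → int-* (int-indicator (Tr.At.side j k c)) (Vec.lookup z c , refl))

  halfOpen-exists : ∀ {z r} → Rep A (point z) r → ∃[ j ] HalfOpen j (point z)
  halfOpen-exists {z} X = from (covered (rep-+ (rep-* 0≤M X) q-rep))
    where
    from : ∃[ j ] InCone (perturb (point z)) j → ∃[ j ] HalfOpen j (point z)
    from (j , y∈j) = j , λ k →
      let 0≤y = subst (0ℚ ≤_) (perturb-coord j k (point z)) (y∈j k) in
      perturbed-nonneg (coord-int j k z) (∣slope∣<M j k) 0≤y ,
      λ s<0 → perturbed-≢0 (coord-int j k z) (∣slope∣<M j k) s<0 0≤y

  -- Where the slope is positive, a nonnegative coordinate suffices. Where it is negative, the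
  -- coordinate is a nonzero natural number, hence at least 1, and `M` outweighs the slope.
  halfOpen⇒interior : ∀ {j z} → HalfOpen j (point z) → ∀ k → 0ℚ < Tr.coord j k (perturb (point z))
  halfOpen⇒interior {j} {z} z∈j k = subst (0ℚ <_) (sym (perturb-coord j k (point z))) ([ negative , positive′ ]′ (slope≢0 j k))
    where
    c = Tr.coord j k (point z)
    c-nat = int-nonneg⇒ℕ (coord-int j k z) (proj₁ (z∈j k))
    1≤c : c ≢ 0ℚ → 1ℚ ≤ c
    1≤c c≢0 = at-least-one c-nat c≢0
      where
      at-least-one : ∀ {x} → ∃[ i ] x ≡ toQ-ℕ i → x ≢ 0ℚ → 1ℚ ≤ x
      at-least-one (zero  , x≡) x≢0 = contradiction x≡ x≢0
      at-least-one (suc i , x≡) x≢0 = subst (1ℚ ≤_) (sym x≡) (toQ-ℕ-mono {1} {suc i} (s≤s z≤n))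
    negative : slope j k < 0ℚ → 0ℚ < M * c + slope j k
    negative s<0 = perturbed-pos′ (coord-int j k z) (∣slope∣<M j k) (1≤c (proj₂ (z∈j k) s<0))
    positive′ : 0ℚ < slope j k → 0ℚ < M * c + slope j k
    positive′ 0<s = perturbed-pos (coord-int j k z) (∣slope∣<M j k) (proj₁ (z∈j k)) 0<s

  halfOpen-unique : ∀ {j j′ z} → total (point z) ≡ 0ℚ → HalfOpen j (point z) → HalfOpen j′ (point z) → j ≡ j′
  halfOpen-unique {j} {j′} {z} Σz≡0 z∈j z∈j′ =
    interior-disjoint (perturb-total {point z} Σz≡0) (halfOpen⇒interior {j} {z} z∈j) (halfOpen⇒interior {j′} {z} z∈j′)

  combination : ∀ j → Vec ℕ (Tr.N j) → Point n
  combination j v = Tr.spanned j (λ k → toQ-ℕ (Vec.lookup v k))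

  combination-int : ∀ j v c → IsInt (combination j v c)
  combination-int j v c = int-sum _ (λ k → int-* (ℤ.+ Vec.lookup v k , refl) (int-arcVec (Tr.tl j k) (Tr.hd j k) c))

  latticePoint : ∀ j → Vec ℕ (Tr.N j) → Vec ℤ n
  latticePoint j v = Vec.tabulate (λ c → proj₁ (combination-int j v c))

  point-latticePoint : ∀ j v c → point (latticePoint j v) c ≡ combination j v c
  point-latticePoint j v c = trans (cong toQ (Vec.lookup∘tabulate _ c)) (sym (proj₂ (combination-int j v c)))

  coord-latticePoint : ∀ j v k → Tr.coord j k (point (latticePoint j v)) ≡ toQ-ℕ (Vec.lookup v k)
  coord-latticePoint j v k = trans (pair-cong (Tr.dual j k) (point-latticePoint j v)) (Tr.coord-spanned j k (λ k → toQ-ℕ (Vec.lookup v k)))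

  latticePoint-injective : ∀ j {v w} → latticePoint j v ≡ latticePoint j w → v ≡ w
  latticePoint-injective j {v} {w} eq = trans (sym (Vec.tabulate∘lookup v)) (trans (Vec.tabulate-cong entries) (Vec.tabulate∘lookup w))
    where
    entries : ∀ k → Vec.lookup v k ≡ Vec.lookup w k
    entries k = toQ-ℕ-injective (trans (sym (coord-latticePoint j v k))
      (trans (cong (λ z → Tr.coord j k (point z)) eq) (coord-latticePoint j w k)))

  block : Fin m → ℕ → List (Vec ℤ n)
  block j t = map (latticePoint j) (bounded (passive j) t)

  block-unique : ∀ j t → Unique (block j t)
  block-unique j t = Unique.map⁺ (latticePoint-injective j) (bounded-unique (passive j) t)

  ∈-block⁻ : ∀ {j t z} → z ∈ block j t → Rep A (point z) (toQ-ℕ t) × HalfOpen j (point z)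
  ∈-block⁻ {j} {t} z∈ = from (∈-map⁻ (latticePoint j) z∈)
    where
    from : ∀ {z} → ∃[ v ] (v ∈ bounded (passive j) t × z ≡ latticePoint j v) →
      Rep A (point z) (toQ-ℕ t) × HalfOpen j (point z)
    from (v , v∈ , refl) = rep-mono ab∈G (A-sym ab∈G)
        (rep-cong (λ c → sym (point-latticePoint j v c)) (trans (sum-cong (λ k → ℚ.*-identityʳ (toQ-ℕ (Vec.lookup v k)))) (sum-toQ-ℕ v))
          (rep-sum (λ k c → toQ-ℕ (Vec.lookup v k) * Tr.basis j k c) (λ k → toQ-ℕ (Vec.lookup v k) * 1ℚ)
            (λ k → rep-* (toQ-ℕ-nonneg (Vec.lookup v k)) (rep-tree⇒rep j (rep-arc (Tr.inT j k))))))
        (toQ-ℕ-mono {Vec.sum v} {t} (proj₂ (∈-bounded⁻ (passive j) t v∈)))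
      , λ k → subst (0ℚ ≤_) (sym (coord-latticePoint j v k)) (toQ-ℕ-nonneg (Vec.lookup v k))
        , λ s<0 coord≡0 → ℕ.<⇒≢ (proj₁ (∈-bounded⁻ (passive j) t v∈) k (passive⁺ j k s<0))
            (sym (toQ-ℕ-injective (trans (sym (coord-latticePoint j v k)) coord≡0)))

  ∈-block⁺ : ∀ {j t z} → Rep A (point z) (toQ-ℕ t) → HalfOpen j (point z) → z ∈ block j t
  ∈-block⁺ {j} {t} {z} Z z∈j = subst (_∈ block j t) (sym z≡) (∈-map⁺ (latticePoint j) (∈-bounded⁺ (passive j) {v = v} positive-on sum≤t))
    where
    natural : ∀ k → ∃[ i ] Tr.coord j k (point z) ≡ toQ-ℕ i
    natural k = int-nonneg⇒ℕ (coord-int j k z) (proj₁ (z∈j k))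
    v : Vec ℕ (Tr.N j)
    v = Vec.tabulate (λ k → proj₁ (natural k))
    coord≡v : ∀ k → Tr.coord j k (point z) ≡ toQ-ℕ (Vec.lookup v k)
    coord≡v k = trans (proj₂ (natural k)) (cong toQ-ℕ (sym (Vec.lookup∘tabulate (λ k → proj₁ (natural k)) k)))
    z≡ : z ≡ latticePoint j v
    z≡ = point-injective λ c → trans (Tr.expansion j (rep-total Z) c)
      (trans (sum-cong (λ k → cong (_* Tr.basis j k c) (coord≡v k))) (sym (point-latticePoint j v c)))
    sum≤t : Vec.sum v ℕ.≤ t
    -- The coordinates sum to the gauge of z, and membership in the dilate bounds the gauge by t.
    sum≤t = toQ-ℕ-cancel-≤ {Vec.sum v} {t} (subst (_≤ toQ-ℕ t) (trans (sum-cong {g = λ k → toQ-ℕ (Vec.lookup v k)} coord≡v) (sum-toQ-ℕ v))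
      (size-minimal j (rep-total Z) (λ k → proj₁ (z∈j k)) Z))
    positive-on : Positive-on (passive j) v
    positive-on k pk = ℕ.n≢0⇒n>0 λ v≡0 → proj₂ (z∈j k) (passive⁻ j k pk) (trans (coord≡v k) (cong toQ-ℕ v≡0))

  passiveArcs : ∀ j → List (Fin n × Fin n)
  passiveArcs j = map (λ k → Tr.tl j k , Tr.hd j k) (truePositions (passive j))

  numSemiPassive : ∀ j → NumSemiPassive G rank (𝒯 j) (trues (passive j))
  numSemiPassive j = passiveArcs j
    , Unique.map⁺ (λ eq → Tr.arc-injective j (cong proj₁ eq) (cong proj₂ eq)) (truePositions-unique (passive j))
    , trans (List.length-map (λ k → Tr.tl j k , Tr.hd j k) (truePositions (passive j))) (length-truePositions (passive j))
    , λ u v → mk⇔ (λ uv∈ → to (∈-map⁻ (λ k → Tr.tl j k , Tr.hd j k) uv∈)) (λ (uv∈T , semi) → from (Tr.index j uv∈T) semi)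
    where
    to : ∀ {u v} → ∃[ k ] (k ∈ truePositions (passive j) × (u , v) ≡ (Tr.tl j k , Tr.hd j k)) →
      𝒯 j u v ≡ true × InternallySemiPassive G rank (𝒯 j) u v
    to (k , k∈ , refl) = Tr.inT j k , [ proj₂ , (λ (0<s , _) → contradiction (passive⁻ j k (∈-truePositions⁻ (passive j) k∈)) (ℚ.<-asym 0<s)) ]′ (Sg.sign j k)
    from : ∀ {u v} → ∃[ k ] (Tr.tl j k ≡ u × Tr.hd j k ≡ v) → InternallySemiPassive G rank (𝒯 j) u v → (u , v) ∈ passiveArcs j
    from (k , refl , refl) semi = ∈-map⁺ (λ k → Tr.tl j k , Tr.hd j k) (∈-truePositions⁺ (passive j) k (passive⁺ j k
      ([ proj₁ , (λ (_ , not-semi) → contradiction semi not-semi) ]′ (Sg.sign j k))))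

  -- `NumTreesWith` counts through a relation between trees and numbers; its functionality gives
  -- every tree a single level, `trues (passive j)`.
  numSemiPassive-unique : ∀ j {k l} → NumSemiPassive G rank (𝒯 j) k → NumSemiPassive G rank (𝒯 j) l → k ≡ l
  numSemiPassive-unique j (es , uniq , refl , es⇔) (es′ , uniq′ , refl , es′⇔) = length-set-equal uniq uniq′
    (λ {(u , v)} e∈ → Equivalence.from (es′⇔ u v) (Equivalence.to (es⇔ u v) e∈))
    (λ {(u , v)} e∈ → Equivalence.from (es⇔ u v) (Equivalence.to (es′⇔ u v) e∈))

  module _ {d} (dim : IsDim (SymEdge G) d) (f : ℕ → ℕ) (trees : ∀ i → NumTreesWith G rank 𝒯 i (f i)) where

    treesWith : ℕ → List (Fin m)
    treesWith i = proj₁ (trees i)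

    treesWith-unique : ∀ i → Unique (treesWith i)
    treesWith-unique i = proj₁ (proj₂ (trees i))

    length-treesWith : ∀ i → length (treesWith i) ≡ f i
    length-treesWith i = proj₁ (proj₂ (proj₂ (trees i)))

    ∈-treesWith⁻ : ∀ {i j} → j ∈ treesWith i → trues (passive j) ≡ i
    ∈-treesWith⁻ {i} {j} j∈ = numSemiPassive-unique j (numSemiPassive j) (Equivalence.to (proj₂ (proj₂ (proj₂ (trees i))) j) j∈)

    ∈-treesWith⁺ : ∀ j → j ∈ treesWith (trues (passive j))
    ∈-treesWith⁺ j = Equivalence.from (proj₂ (proj₂ (proj₂ (trees (trues (passive j))))) j) (numSemiPassive j)

    passive≤d : ∀ j → trues (passive j) ℕ.≤ d
    passive≤d j = subst (trues (passive j) ℕ.≤_) (N≡dim G ab∈G (isTree j) dim) (trues≤ (passive j))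

    vanish-above : ∀ k → d ℕ.< k → f k ≡ 0
    vanish-above k d<k = trans (sym (length-treesWith k)) (empty (treesWith k) ∈-treesWith⁻)
      where
      empty : ∀ js → (∀ {j} → j ∈ js → trues (passive j) ≡ k) → length js ≡ 0
      empty []       _     = refl
      empty (j ∷ js) count = contradiction (subst (ℕ._≤ d) (count (here refl)) (passive≤d j)) (ℕ.<⇒≱ d<k)

    level : ℕ → ℕ → List (Vec ℤ n)
    level t i = concatMap (λ j → block j t) (treesWith i)

    ∈-level⁻ : ∀ {t i z} → z ∈ level t i → ∃[ j ] (j ∈ treesWith i × z ∈ block j t)
    ∈-level⁻ {t} z∈ = find (∈-concatMap⁻ (λ j → block j t) z∈)

    same-block : ∀ {t j j′ z} → z ∈ block j t → z ∈ block j′ t → j ≡ j′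
    same-block {t} {j} {j′} {z} z∈j z∈j′ = halfOpen-unique {j} {j′} {z} (rep-total (proj₁ (∈-block⁻ {j} {t} z∈j)))
      (proj₂ (∈-block⁻ {j} {t} z∈j)) (proj₂ (∈-block⁻ {j′} {t} z∈j′))

    length-block : ∀ {t i j} → j ∈ treesWith i → length (block j t) ≡ (t ℕ.+ d ℕ.∸ i) C d
    length-block {t} {i} {j} j∈ = trans (List.length-map (latticePoint j) (bounded (passive j) t))
      (trans (length-bounded (passive j) t)
        (cong₂ (λ N i → (t ℕ.+ N ℕ.∸ i) C N) (N≡dim G ab∈G (isTree j) dim) (∈-treesWith⁻ j∈)))

    latticePoints : ℕ → List (Vec ℤ n)
    latticePoints t = concatMap (level t) (upTo (suc d))

    length-latticePoints : ∀ t → length (latticePoints t) ≡ sumUpTo d (λ i → f i ℕ.* ((t ℕ.+ d ℕ.∸ i) C d))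
    length-latticePoints t = trans (length-concatMap (level t) (upTo (suc d))) (sum-map-cong (upTo (suc d)) λ i →
      trans (length-concatMap (λ j → block j t) (treesWith i))
        (trans (sum-map-const (λ j → length (block j t)) ((t ℕ.+ d ℕ.∸ i) C d) (treesWith i) length-block)
          (cong (ℕ._* ((t ℕ.+ d ℕ.∸ i) C d)) (length-treesWith i))))

    latticePoints-unique : ∀ t → Unique (latticePoints t)
    latticePoints-unique t = concatMap-unique (level t) (Unique.upTo⁺ (suc d))
      (λ i → concatMap-unique (λ j → block j t) (treesWith-unique i) (λ j → block-unique j t) (λ _ _ → same-block))
      (λ _ _ z∈i z∈i′ → same-level (∈-level⁻ z∈i) (∈-level⁻ z∈i′))
      where
      same-level : ∀ {i i′ z} → ∃[ j ] (j ∈ treesWith i × z ∈ block j t) → ∃[ j ] (j ∈ treesWith i′ × z ∈ block j t) → i ≡ i′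
      same-level (j , j∈i , z∈j) (j′ , j′∈i′ , z∈j′) = trans (sym (∈-treesWith⁻ j∈i))
        (trans (cong (λ j → trues (passive j)) (same-block z∈j z∈j′)) (∈-treesWith⁻ j′∈i′))

    latticeCount : ∀ t → LatticeCount (SymEdge G) t (sumUpTo d (λ i → f i ℕ.* ((t ℕ.+ d ℕ.∸ i) C d)))
    latticeCount t = latticePoints t , latticePoints-unique t , length-latticePoints t , λ z → mk⇔ (to z) (from z)
      where
      to : ∀ z → z ∈ latticePoints t → Dilate t (SymEdge G) (point z)
      to z z∈ = let (i , _ , z∈i) = find (∈-concatMap⁻ (level t) {xs = upTo (suc d)} z∈)
                    (j , _ , z∈j) = ∈-level⁻ z∈i
                in rep⇒dilate t (proj₁ (∈-block⁻ {j} {t} z∈j))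
      place : ∀ z → Rep A (point z) (toQ-ℕ t) → ∃[ j ] HalfOpen j (point z) → z ∈ latticePoints t
      place z Z (j , z∈j) = ∈-concatMap⁺ (level t) (lose (∈-upTo⁺ (s≤s (passive≤d j)))
        (∈-concatMap⁺ (λ j → block j t) (lose (∈-treesWith⁺ j) (∈-block⁺ {j} {t} {z} Z z∈j))))
      from : ∀ z → Dilate t (SymEdge G) (point z) → z ∈ latticePoints t
      from z z∈tP = place z (dilate⇒rep t z∈tP) (halfOpen-exists {z} (dilate⇒rep t z∈tP))

-- Coefficients that sum to 1 cannot all vanish. The dimension hypothesis supplies at least one
-- point of the polytope, so this rules out an edgeless graph and yields the arc `ab` used
-- throughout.
conv⇒arc : ∀ {n} {A : ArcSet n} {x} → ConvArcs A x → ∃[ a ] ∃[ b ] A a b ≡ true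
conv⇒arc {n} {A} (l , _ , supp , Σl , _) with Fin.any? (λ a → Fin.any? (λ b → A a b Bool.≟ true))
... | yes arc = arc
... | no  ∄arc = contradiction (trans (sym Σl) (trans (sumArcs-1 l) (sum₂-zero λ t h → supp t h (Bool.¬-not (λ th∈A → ∄arc (t , h , th∈A)))))) ℚ.1≢0

theorem1p7 : ∀ {n m} (G : SimpleGraph n) (𝒯 : Fin m → ArcSet n)
    → DissectingTreeSet G 𝒯
    → (rank : Fin n → Fin n → ℕ) → IsArcOrder G rank
    → (d : ℕ) → IsDim (SymEdge G) d
    → (a : ℕ → ℕ) → (∀ i → NumTreesWith G rank 𝒯 i (a i))
    → IsHStarCoeffs (SymEdge G) d a
theorem1p7 G 𝒯 dissecting rank order d dim@((_ , q∈P , _) , _) a trees =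
  let (_ , _ , ab∈G) = conv⇒arc (q∈P zero)
      open Count G 𝒯 dissecting ab∈G rank order
  in vanish-above dim a trees , latticeCount dim a trees
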